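{- Let $g\in\mathbb{F}_q[t]$ be a composite polynomial. Then $g$ is a Carmichael polynomial if and only if (1) $g$ is square-free, and (2) $\deg P$ divides $\deg g$ for every irreducible factor $P$ of $g$.
   Context: $\mathbb{F}_q$ is the finite field with $q$ elements. A composite polynomial is a nonzero, non-constant polynomial that is not irreducible. A finite ring $S$ is a Carmichael ring if $S$ is not a field and $a^{|S|}=a$ for every $a\in S$. A polynomial $g\in\mathbb{F}_q[t]$ is a Carmichael polynomial if $\mathbb{F}_q[t]/(g)$ is a Carmichael ring. -}

module Defs where

open import Algebra.Bundles using (AbelianGroup; CommutativeRing; Ring)
import Algebra.Properties.CommutativeSemigroup as CommutativeSemigroupProperties
import Algebra.Properties.Ring as RingProperties
import Algebra.Properties.Semiring.Divisibility as SemiringDivisibility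
import Algebra.Properties.Semiring.Exp as SemiringExp
import Algebra.Properties.Semiring.Primality as SemiringPrimality
open import Data.Bool.Base using (if_then_else_)
open import Data.Fin.Base using (Fin)
import Data.Fin.Properties as Fin
open import Data.List.Base using (List; []; _∷_; foldr; length; map)
open import Data.Nat.Base using (ℕ; zero; suc; pred)
open import Data.Product.Base using (∃; _,_)
open import Function.Bundles using (Inverse)
open import Function.Properties.Inverse using (Inverse⇒Injection)
open import Level using (Level; _⊔_) renaming (suc to lsuc)
open import Relation.Binary.Bundles using (Setoid)
open import Relation.Binary.Core using (Rel)
open import Relation.Binary.Definitions using (Decidable)
import Relation.Binary.PropositionalEquality.Properties as ≡
import Relation.Binary.Reasoning.Setoid as SetoidReasoning
open import Relation.Nullary.Decidable using (does; via-injection)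
open import Relation.Nullary.Negation.Core using (¬_)

private
  variable
    c ℓ : Level

HasCardinality : Setoid c ℓ → ℕ → Set (c ⊔ ℓ)
HasCardinality S n = Inverse S (≡.setoid (Fin n))

record IsField (R : Ring c ℓ) : Set (c ⊔ ℓ) where
  open Ring R
  field
    *-comm  : ∀ x y → x * y ≈ y * x
    1≉0     : 1# ≉ 0#
    inverse : ∀ x → x ≉ 0# → ∃ λ y → x * y ≈ 1#

record FiniteField c ℓ : Set (lsuc (c ⊔ ℓ)) where
  field
    ring    : Ring c ℓ
    isField : IsField ring
    q       : ℕ
    finite  : HasCardinality (Ring.setoid ring) q

  commutativeRing : CommutativeRing c ℓ
  commutativeRing = record
    { isCommutativeRing = record
      { isRing = Ring.isRing ring
      ; *-comm = IsField.*-comm isField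
      }
    }

  infix 4 _≟_
  _≟_ : Decidable (Ring._≈_ ring)
  _≟_ = via-injection (Inverse⇒Injection finite) Fin._≟_

record IsCarmichaelRing (S : Ring c ℓ) : Set (c ⊔ ℓ) where
  open Ring S
  open SemiringExp semiring using (_^_)
  field
    size     : ℕ
    finite   : HasCardinality setoid size
    notField : ¬ IsField S
    a^|S|≈a  : ∀ a → a ^ size ≈ a

-- The quotient R/(g) keeps the elements of R and coarsens the equality to
-- congruence modulo g.
module Quotient (R : CommutativeRing c ℓ) (g : CommutativeRing.Carrier R) where
  open CommutativeRing R
  open SemiringDivisibility semiring using (_∣_; _,_; _∣0; ∣ʳ-respʳ-≈; x∣ʳy⇒x∣ʳzy)
  open RingProperties ring
    using (x[y-z]≈xy-xz; -‿distribˡ-*; ⁻¹-anti-homo‿-; -‿+-comm)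
  open CommutativeSemigroupProperties +-commutativeSemigroup using (interchange)
  open SetoidReasoning setoid

  infix 4 _≈ₘ_
  _≈ₘ_ : Rel Carrier (c ⊔ ℓ)
  x ≈ₘ y = g ∣ x - y

  private
    reflexiveₘ : ∀ {x y} → x ≈ y → x ≈ₘ y
    reflexiveₘ {x} {y} x≈y = ∣ʳ-respʳ-≈ (sym (trans (+-congʳ x≈y) (-‿inverseʳ y))) (g ∣0)

    neg : ∀ {x} → g ∣ x → g ∣ - x
    neg (h , hg≈x) = - h , trans (sym (-‿distribˡ-* h g)) (-‿cong hg≈x)

    add : ∀ {x y} → g ∣ x → g ∣ y → g ∣ x + y
    add (h , hg≈x) (k , kg≈y) = h + k , trans (distribʳ g h k) (+-cong hg≈x kg≈y)

    symₘ : ∀ {x y} → x ≈ₘ y → y ≈ₘ x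
    symₘ {x} {y} d = ∣ʳ-respʳ-≈ (⁻¹-anti-homo‿- x y) (neg d)

    telescope : ∀ x y z → (x - y) + (y - z) ≈ x - z
    telescope x y z = begin
      (x - y) + (y - z)    ≈⟨ +-assoc x (- y) (y - z) ⟩
      x + (- y + (y - z))  ≈⟨ +-congˡ (+-assoc (- y) y (- z)) ⟨
      x + (- y + y - z)    ≈⟨ +-congˡ (+-congʳ (-‿inverseˡ y)) ⟩
      x + (0# - z)         ≈⟨ +-congˡ (+-identityˡ (- z)) ⟩
      x - z                ∎

    transₘ : ∀ {x y z} → x ≈ₘ y → y ≈ₘ z → x ≈ₘ z
    transₘ {x} {y} {z} d e = ∣ʳ-respʳ-≈ (telescope x y z) (add d e)

    +-congₘ : ∀ {x y u v} → x ≈ₘ y → u ≈ₘ v → x + u ≈ₘ y + v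
    +-congₘ {x} {y} {u} {v} d e = ∣ʳ-respʳ-≈
      (trans (interchange x (- y) u (- v)) (+-congˡ (-‿+-comm y v)))
      (add d e)

    -‿congₘ : ∀ {x y} → x ≈ₘ y → - x ≈ₘ - y
    -‿congₘ {x} {y} d = ∣ʳ-respʳ-≈ (sym (-‿+-comm x (- y))) (neg d)

    *-congₘ : ∀ {x y u v} → x ≈ₘ y → u ≈ₘ v → x * u ≈ₘ y * v
    *-congₘ {x} {y} {u} {v} d e = transₘ {y = x * v}
      (∣ʳ-respʳ-≈ (x[y-z]≈xy-xz x u v) (x∣ʳy⇒x∣ʳzy x e))
      (∣ʳ-respʳ-≈ (trans (x[y-z]≈xy-xz v x y) (+-cong (*-comm v x) (-‿cong (*-comm v y))))
                  (x∣ʳy⇒x∣ʳzy v d))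

  quotient : CommutativeRing c (c ⊔ ℓ)
  quotient = record
    { Carrier = Carrier
    ; _≈_ = _≈ₘ_
    ; _+_ = _+_
    ; _*_ = _*_
    ; -_ = -_
    ; 0# = 0#
    ; 1# = 1#
    ; isCommutativeRing = record
      { isRing = record
        { +-isAbelianGroup = record
          { isGroup = record
            { isMonoid = record
              { isSemigroup = record
                { isMagma = record
                  { isEquivalence = record
                    { refl = reflexiveₘ refl
                    ; sym = λ {x} {y} → symₘ {x} {y}
                    ; trans = λ {x} {y} {z} → transₘ {x} {y} {z}
                    }
                  ; ∙-cong = λ {x} {y} {u} {v} → +-congₘ {x} {y} {u} {v}
                  }
                ; assoc = λ x y z → reflexiveₘ (+-assoc x y z)
                }
              ; identity = (λ x → reflexiveₘ (+-identityˡ x)) , (λ x → reflexiveₘ (+-identityʳ x))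
              }
            ; inverse = (λ x → reflexiveₘ (-‿inverseˡ x)) , (λ x → reflexiveₘ (-‿inverseʳ x))
            ; ⁻¹-cong = λ {x} {y} → -‿congₘ {x} {y}
            }
          ; comm = λ x y → reflexiveₘ (+-comm x y)
          }
        ; *-cong = λ {x} {y} {u} {v} → *-congₘ {x} {y} {u} {v}
        ; *-assoc = λ x y z → reflexiveₘ (*-assoc x y z)
        ; *-identity = (λ x → reflexiveₘ (*-identityˡ x)) , (λ x → reflexiveₘ (*-identityʳ x))
        ; distrib = (λ x y z → reflexiveₘ (distribˡ x y z)) , (λ x y z → reflexiveₘ (distribʳ x y z))
        }
      ; *-comm = λ x y → reflexiveₘ (*-comm x y)
      }
    }

-- A polynomial is its list of coefficients, constant term first; two lists
-- are equal when they agree up to trailing zeros.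
module Polynomials (R : CommutativeRing c ℓ) where
  open CommutativeRing R
  open RingProperties ring using (-0#≈0#)
  open CommutativeSemigroupProperties +-commutativeSemigroup using (interchange; x∙yz≈y∙xz)

  Poly : Set c
  Poly = List Carrier

  coeff : Poly → ℕ → Carrier
  coeff []      _       = 0#
  coeff (a ∷ p) zero    = a
  coeff (a ∷ p) (suc n) = coeff p n

  infix 4 _≈ₚ_
  record _≈ₚ_ (p r : Poly) : Set ℓ where
    constructor coeffwise
    field
      at : ∀ n → coeff p n ≈ coeff r n
  open _≈ₚ_ public

  infixl 6 _+ₚ_
  infixl 7 _*ₚ_ _·ₚ_
  infix  8 -ₚ_

  _+ₚ_ : Poly → Poly → Poly
  []      +ₚ r       = r
  (a ∷ p) +ₚ []      = a ∷ p
  (a ∷ p) +ₚ (b ∷ r) = a + b ∷ p +ₚ r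

  -ₚ_ : Poly → Poly
  -ₚ_ = map (-_)

  _·ₚ_ : Carrier → Poly → Poly
  a ·ₚ p = map (a *_) p

  -- (a + t p) r = a r + t (p r)
  _*ₚ_ : Poly → Poly → Poly
  []      *ₚ r = []
  (a ∷ p) *ₚ r = a ·ₚ r +ₚ (0# ∷ p *ₚ r)

  coeff-+ : ∀ p r n → coeff (p +ₚ r) n ≈ coeff p n + coeff r n
  coeff-+ []      r       n       = sym (+-identityˡ _)
  coeff-+ (a ∷ p) []      n       = sym (+-identityʳ _)
  coeff-+ (a ∷ p) (b ∷ r) zero    = refl
  coeff-+ (a ∷ p) (b ∷ r) (suc n) = coeff-+ p r n

  coeff-neg : ∀ p n → coeff (-ₚ p) n ≈ - coeff p n
  coeff-neg []      n       = sym -0#≈0#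
  coeff-neg (a ∷ p) zero    = refl
  coeff-neg (a ∷ p) (suc n) = coeff-neg p n

  coeff-· : ∀ a p n → coeff (a ·ₚ p) n ≈ a * coeff p n
  coeff-· a []      n       = sym (zeroʳ a)
  coeff-· a (b ∷ p) zero    = refl
  coeff-· a (b ∷ p) (suc n) = coeff-· a p n

  +ₚ-abelianGroup : AbelianGroup c ℓ
  +ₚ-abelianGroup = record
    { Carrier = Poly
    ; _≈_ = _≈ₚ_
    ; _∙_ = _+ₚ_
    ; ε = []
    ; _⁻¹ = -ₚ_
    ; isAbelianGroup = record
      { isGroup = record
        { isMonoid = record
          { isSemigroup = record
            { isMagma = record
              { isEquivalence = record
                { refl = coeffwise λ _ → refl
                ; sym = λ e → coeffwise λ n → sym (at e n)
                ; trans = λ e f → coeffwise λ n → trans (at e n) (at f n)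
                }
              ; ∙-cong = λ {p} {p′} {r} {r′} e f → coeffwise λ n →
                  trans (coeff-+ p r n)
                    (trans (+-cong (at e n) (at f n)) (sym (coeff-+ p′ r′ n)))
              }
            ; assoc = λ p r s → coeffwise λ n →
                trans (trans (coeff-+ (p +ₚ r) s n) (+-congʳ (coeff-+ p r n)))
                  (trans (+-assoc _ _ _)
                    (sym (trans (coeff-+ p (r +ₚ s) n) (+-congˡ (coeff-+ r s n)))))
            }
          ; identity = (λ p → coeffwise λ n → trans (coeff-+ [] p n) (+-identityˡ _))
                     , (λ p → coeffwise λ n → trans (coeff-+ p [] n) (+-identityʳ _))
          }
        ; inverse = (λ p → coeffwise λ n →
                      trans (coeff-+ (-ₚ p) p n) (trans (+-congʳ (coeff-neg p n)) (-‿inverseˡ _)))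
                  , (λ p → coeffwise λ n →
                      trans (coeff-+ p (-ₚ p) n) (trans (+-congˡ (coeff-neg p n)) (-‿inverseʳ _)))
        ; ⁻¹-cong = λ {p} {r} e → coeffwise λ n →
            trans (coeff-neg p n) (trans (-‿cong (at e n)) (sym (coeff-neg r n)))
        }
      ; comm = λ p r → coeffwise λ n →
          trans (coeff-+ p r n) (trans (+-comm _ _) (sym (coeff-+ r p n)))
      }
    }

  private
    module A = AbelianGroup +ₚ-abelianGroup
    module A′ = CommutativeSemigroupProperties A.commutativeSemigroup
    open SetoidReasoning A.setoid

  ·-cong : ∀ {a b p r} → a ≈ b → p ≈ₚ r → a ·ₚ p ≈ₚ b ·ₚ r
  ·-cong {a} {b} {p} {r} e f = coeffwise λ n →
    trans (coeff-· a p n) (trans (*-cong e (at f n)) (sym (coeff-· b r n)))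

  ·-distrib : ∀ a p r → a ·ₚ (p +ₚ r) ≈ₚ a ·ₚ p +ₚ a ·ₚ r
  ·-distrib a p r = coeffwise λ n →
    trans (trans (coeff-· a (p +ₚ r) n) (*-congˡ (coeff-+ p r n)))
      (trans (distribˡ _ _ _)
        (sym (trans (coeff-+ (a ·ₚ p) (a ·ₚ r) n) (+-cong (coeff-· a p n) (coeff-· a r n)))))

  ·-assoc : ∀ a b p → (a * b) ·ₚ p ≈ₚ a ·ₚ (b ·ₚ p)
  ·-assoc a b p = coeffwise λ n →
    trans (coeff-· (a * b) p n)
      (trans (*-assoc _ _ _) (sym (trans (coeff-· a (b ·ₚ p) n) (*-congˡ (coeff-· b p n)))))

  ·-zero : ∀ p → 0# ·ₚ p ≈ₚ []
  ·-zero p = coeffwise λ n → trans (coeff-· 0# p n) (zeroˡ _)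

  ·-one : ∀ p → 1# ·ₚ p ≈ₚ p
  ·-one p = coeffwise λ n → trans (coeff-· 1# p n) (*-identityˡ _)

  ∷-cong : ∀ {a b p r} → a ≈ b → p ≈ₚ r → a ∷ p ≈ₚ b ∷ r
  ∷-cong e f = coeffwise λ { zero → e ; (suc n) → at f n }

  0∷[] : 0# ∷ [] ≈ₚ []
  0∷[] = coeffwise λ { zero → refl ; (suc n) → refl }

  shift-+ : ∀ p r → 0# ∷ (p +ₚ r) ≈ₚ (0# ∷ p) +ₚ (0# ∷ r)
  shift-+ p r = ∷-cong (sym (+-identityˡ 0#)) A.refl

  shift-· : ∀ a p → 0# ∷ (a ·ₚ p) ≈ₚ a ·ₚ (0# ∷ p)
  shift-· a p = ∷-cong (sym (zeroʳ a)) A.refl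

  *-congˡₚ : ∀ p {r s} → r ≈ₚ s → p *ₚ r ≈ₚ p *ₚ s
  *-congˡₚ []      e = A.refl
  *-congˡₚ (a ∷ p) e = A.∙-cong (·-cong refl e) (∷-cong refl (*-congˡₚ p e))

  *-zeroʳₚ : ∀ p → p *ₚ [] ≈ₚ []
  *-zeroʳₚ []      = A.refl
  *-zeroʳₚ (a ∷ p) = A.trans (∷-cong refl (*-zeroʳₚ p)) 0∷[]

  *-∷ʳ : ∀ p b r → p *ₚ (b ∷ r) ≈ₚ b ·ₚ p +ₚ (0# ∷ p *ₚ r)
  *-∷ʳ []      b r = A.sym 0∷[]
  *-∷ʳ (a ∷ p) b r = ∷-cong (+-congʳ (*-comm a b)) (begin
    a ·ₚ r +ₚ p *ₚ (b ∷ r)                ≈⟨ A.∙-congˡ {a ·ₚ r} (*-∷ʳ p b r) ⟩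
    a ·ₚ r +ₚ (b ·ₚ p +ₚ (0# ∷ p *ₚ r))    ≈⟨ A′.x∙yz≈y∙xz (a ·ₚ r) (b ·ₚ p) _ ⟩
    b ·ₚ p +ₚ (a ·ₚ r +ₚ (0# ∷ p *ₚ r))    ∎)

  *-commₚ : ∀ p r → p *ₚ r ≈ₚ r *ₚ p
  *-commₚ []      r = A.sym (*-zeroʳₚ r)
  *-commₚ (a ∷ p) r = begin
    a ·ₚ r +ₚ (0# ∷ p *ₚ r)  ≈⟨ A.∙-congˡ {a ·ₚ r} (∷-cong refl (*-commₚ p r)) ⟩
    a ·ₚ r +ₚ (0# ∷ r *ₚ p)  ≈⟨ *-∷ʳ r a p ⟨
    r *ₚ (a ∷ p)             ∎

  *-congₚ : ∀ {p p′ r r′} → p ≈ₚ p′ → r ≈ₚ r′ → p *ₚ r ≈ₚ p′ *ₚ r′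
  *-congₚ {p} {p′} {r} {r′} e f = begin
    p *ₚ r    ≈⟨ *-congˡₚ p f ⟩
    p *ₚ r′   ≈⟨ *-commₚ p r′ ⟩
    r′ *ₚ p   ≈⟨ *-congˡₚ r′ e ⟩
    r′ *ₚ p′  ≈⟨ *-commₚ r′ p′ ⟩
    p′ *ₚ r′  ∎

  distribˡₚ : ∀ p r s → p *ₚ (r +ₚ s) ≈ₚ p *ₚ r +ₚ p *ₚ s
  distribˡₚ []      r s = A.refl
  distribˡₚ (a ∷ p) r s = begin
    a ·ₚ (r +ₚ s) +ₚ (0# ∷ p *ₚ (r +ₚ s))
      ≈⟨ A.∙-cong (·-distrib a r s)
           (A.trans (∷-cong refl (distribˡₚ p r s)) (shift-+ (p *ₚ r) (p *ₚ s))) ⟩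
    (a ·ₚ r +ₚ a ·ₚ s) +ₚ ((0# ∷ p *ₚ r) +ₚ (0# ∷ p *ₚ s))
      ≈⟨ A′.interchange (a ·ₚ r) (a ·ₚ s) (0# ∷ p *ₚ r) (0# ∷ p *ₚ s) ⟩
    (a ·ₚ r +ₚ (0# ∷ p *ₚ r)) +ₚ (a ·ₚ s +ₚ (0# ∷ p *ₚ s))
      ∎

  distribʳₚ : ∀ s p r → (p +ₚ r) *ₚ s ≈ₚ p *ₚ s +ₚ r *ₚ s
  distribʳₚ s p r = begin
    (p +ₚ r) *ₚ s       ≈⟨ *-commₚ (p +ₚ r) s ⟩
    s *ₚ (p +ₚ r)       ≈⟨ distribˡₚ s p r ⟩
    s *ₚ p +ₚ s *ₚ r    ≈⟨ A.∙-cong (*-commₚ s p) (*-commₚ s r) ⟩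
    p *ₚ s +ₚ r *ₚ s    ∎

  ·-*-assoc : ∀ a p r → (a ·ₚ p) *ₚ r ≈ₚ a ·ₚ (p *ₚ r)
  ·-*-assoc a []      r = A.refl
  ·-*-assoc a (b ∷ p) r = begin
    (a * b) ·ₚ r +ₚ (0# ∷ (a ·ₚ p) *ₚ r)
      ≈⟨ A.∙-cong (·-assoc a b r)
           (A.trans (∷-cong refl (·-*-assoc a p r)) (shift-· a (p *ₚ r))) ⟩
    a ·ₚ (b ·ₚ r) +ₚ a ·ₚ (0# ∷ p *ₚ r)
      ≈⟨ ·-distrib a (b ·ₚ r) (0# ∷ p *ₚ r) ⟨
    a ·ₚ (b ·ₚ r +ₚ (0# ∷ p *ₚ r))
      ∎

  *-assocₚ : ∀ p r s → (p *ₚ r) *ₚ s ≈ₚ p *ₚ (r *ₚ s)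
  *-assocₚ []      r s = A.refl
  *-assocₚ (a ∷ p) r s = begin
    (a ·ₚ r +ₚ (0# ∷ p *ₚ r)) *ₚ s
      ≈⟨ distribʳₚ s (a ·ₚ r) (0# ∷ p *ₚ r) ⟩
    (a ·ₚ r) *ₚ s +ₚ (0# ·ₚ s +ₚ (0# ∷ (p *ₚ r) *ₚ s))
      ≈⟨ A.∙-cong (·-*-assoc a r s) (A.∙-cong (·-zero s) (∷-cong refl (*-assocₚ p r s))) ⟩
    a ·ₚ (r *ₚ s) +ₚ (0# ∷ p *ₚ (r *ₚ s))
      ∎

  *-identityˡₚ : ∀ p → (1# ∷ []) *ₚ p ≈ₚ p
  *-identityˡₚ p = A.trans (A.∙-cong (·-one p) 0∷[]) (A.identityʳ p)

  polynomialRing : CommutativeRing c ℓ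
  polynomialRing = record
    { Carrier = Poly
    ; _≈_ = _≈ₚ_
    ; _+_ = _+ₚ_
    ; _*_ = _*ₚ_
    ; -_ = -ₚ_
    ; 0# = []
    ; 1# = 1# ∷ []
    ; isCommutativeRing = record
      { isRing = record
        { +-isAbelianGroup = A.isAbelianGroup
        ; *-cong = *-congₚ
        ; *-assoc = *-assocₚ
        ; *-identity = *-identityˡₚ , (λ p → A.trans (*-commₚ p (1# ∷ [])) (*-identityˡₚ p))
        ; distrib = distribˡₚ , distribʳₚ
        }
      ; *-comm = *-commₚ
      }
    }

module PolynomialsOver (F : FiniteField c ℓ) where
  open FiniteField F using (commutativeRing; _≟_)
  open CommutativeRing commutativeRing using (Carrier; 0#)
  open Polynomials commutativeRing public using (Poly; polynomialRing)

  private
    module F[t] = CommutativeRing polynomialRing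

  open SemiringDivisibility F[t].semiring public using (_∣_)
  open SemiringPrimality F[t].semiring public using (Irreducible)

  infixr 5 _∷₀_
  _∷₀_ : Carrier → Poly → Poly
  a ∷₀ []      = if does (a ≟ 0#) then [] else a ∷ []
  a ∷₀ (b ∷ p) = a ∷ b ∷ p

  dropTrailingZeros : Poly → Poly
  dropTrailingZeros = foldr _∷₀_ []

  -- The zero polynomial gets the junk value 0.
  degree : Poly → ℕ
  degree p = pred (length (dropTrailingZeros p))

  IsConstant : Poly → Set (c ⊔ ℓ)
  IsConstant p = ∃ λ a → p F[t].≈ a ∷ []

  record IsComposite (g : Poly) : Set (c ⊔ ℓ) where
    field
      nonzero        : g F[t].≉ F[t].0#
      nonconstant    : ¬ IsConstant g
      notIrreducible : ¬ Irreducible g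

  IsSquareFree : Poly → Set (c ⊔ ℓ)
  IsSquareFree g = ∀ d → d F[t].* d ∣ g → d ∣ F[t].1#

  F[t]/⟨_⟩ : Poly → CommutativeRing c (c ⊔ ℓ)
  F[t]/⟨ g ⟩ = Quotient.quotient polynomialRing g

  IsCarmichaelPolynomial : Poly → Set (c ⊔ ℓ)
  IsCarmichaelPolynomial g = IsCarmichaelRing (CommutativeRing.ring F[t]/⟨ g ⟩)

{-# OPTIONS --safe #-}
-- A ring in which every a satisfies a^N ≈ a, N ≥ 2, has no nonzero nilpotents, so a
-- Carmichael g is square-free. If P is an irreducible factor of g with d = deg P and
-- n = deg g, then every element of the field K = F[t]/(P) satisfies a^(q^n) ≈ a, and
-- a^(q^d) ≈ a since |K| = q^d. Hence a^(q^r) ≈ a for r = n mod d, and as t^(q^r) - t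
-- has at most q^r < q^d roots in K, r = 0. Conversely, if deg P divides n then P
-- divides a^(q^n) - a, and a square-free g divides whatever all its irreducible
-- factors divide.
module Submission where

open import Defs
open import Data.Nat.Divisibility using () renaming (_∣_ to _∣ℕ_)
open import Data.Product.Base using (_×_)
open import Function.Bundles using (_⇔_)

open import Algebra.Bundles using (CommutativeRing)
import Algebra.Properties.AbelianGroup as AbelianGroupProperties
import Algebra.Properties.CommutativeMonoid.Sum as CommutativeMonoidSum
import Algebra.Properties.CommutativeSemigroup as CommutativeSemigroupProperties
import Algebra.Properties.Ring as RingProperties
import Algebra.Properties.Semiring.Divisibility as SemiringDivisibility
import Algebra.Properties.Semiring.Exp as SemiringExp
import Algebra.Properties.Semiring.Primality as SemiringPrimality
open import Data.Bool.Base using (if_then_else_)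
open import Data.Fin.Base using (Fin; inject≤; toℕ; fromℕ<; combine; finToFun; funToFin)
open import Data.Fin.Permutation using (Permutation; permutation; ↔⇒≡)
open import Data.Fin.Properties
  using (punchInᵢ≢i; suc-injective; 0≢1+n; inject≤-injective; toℕ-fromℕ<; finToFun-funToFin; funToFin-finToFin)
open import Data.List.Base using ([]; _∷_; length; tabulate)
open import Data.List.Properties using (length-tabulate)
open import Data.Nat.Base as ℕ
  using (ℕ; zero; suc; pred; _≤_; _<_; z≤n; s≤s; s≤s⁻¹; NonZero; >-nonZero)
open import Data.Nat.Divisibility using (divides; m%n≡0⇒n∣m)
open import Data.Nat.DivMod using (_%_; _/_; m%n<n; m≡m%n+[m/n]*n)
open import Data.Nat.Properties as ℕ
  using (≤-refl; ≤-trans; m≤n+m; n≤1+n; m≤n⇒m<n∨m≡n; ≮⇒≥; ≰⇒>; m<n⇒m<1+n; ^-monoʳ-<)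
open import Data.Product.Base using (_,_; ∃; ∃₂; proj₁; proj₂)
open import Data.Sum.Base using (_⊎_; inj₁; inj₂)
open import Data.Vec.Functional using (replicate; removeAt)
open import Function.Base using (case_of_)
open import Function.Bundles using (Inverse; mk⇔)
import Function.Construct.Composition as Composition
import Function.Construct.Symmetry as Symmetry
open import Level using (_⊔_)
open import Relation.Binary.Bundles using (Setoid)
open import Relation.Binary.PropositionalEquality.Core as ≡ using (_≡_)
open import Relation.Binary.PropositionalEquality.Properties using (module ≡-Reasoning)
import Relation.Binary.Reasoning.Setoid as SetoidReasoning
open import Relation.Nullary.Decidable using (Dec; does; yes; no; dec-true; dec-false; decidable-stable)
open import Relation.Nullary.Negation using (¬_; contradiction)

-- Fermat's identity and the root bound are needed with K = F[t]/(P) itself as the field of scalars,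
-- so both are proved for an arbitrary finite field and K is then packaged as one. This requires two
-- things of the quotient: inverses, which come from the Euclidean algorithm, and a count of its
-- elements by remainders. The same count, made for g, identifies the exponent |F[t]/(g)| of the
-- Carmichael identity with q^n. The converse must also exclude that F[t]/(g) is a field: a field
-- has no zero divisors, which would make g irreducible. The absence of zero divisors in K is in
-- turn Euclid's lemma for P, and that allows irreducible factors to be divided out of g one at a
-- time.

funToFin-cong : ∀ {k m} {f h : Fin k → Fin m} → (∀ i → f i ≡ h i) → funToFin f ≡ funToFin h
funToFin-cong {zero}  e = ≡.refl
funToFin-cong {suc k} e = ≡.cong₂ combine (e Fin.zero) (funToFin-cong λ i → e (Fin.suc i))

cardinality-unique : ∀ {c ℓ} {S : Setoid c ℓ} {m n} → HasCardinality S m → HasCardinality S n → m ≡ n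
cardinality-unique finₘ finₙ = ↔⇒≡ (Composition.inverse (Symmetry.inverse finₘ) finₙ)

-- Fermat's identity in a finite field

module FiniteFieldProperties {c ℓ} (F : FiniteField c ℓ) where
  open FiniteField F using (commutativeRing; isField; _≟_; q; finite)
  open CommutativeRing commutativeRing
  open IsField isField using (1≉0; inverse)
  open SemiringExp semiring using (_^_; ^-congˡ; ^-assocʳ)
  open CommutativeMonoidSum *-commutativeMonoid
    renaming (sum to product; sum-cong-≋ to product-cong; sum-remove to product-remove;
              sum-permute to product-permute; ∑-distrib-+ to ∏-distrib-*;
              sum-replicate to product-replicate)
  open SetoidReasoning setoid

  cancel-*ˡ : ∀ {x} y z → x ≉ 0# → x * y ≈ x * z → y ≈ z
  cancel-*ˡ {x} y z x≉0 e with inverse x x≉0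
  ... | x⁻¹ , xx⁻¹≈1 = begin
    y              ≈⟨ strip y ⟨
    x⁻¹ * (x * y)  ≈⟨ *-congˡ e ⟩
    x⁻¹ * (x * z)  ≈⟨ strip z ⟩
    z              ∎
    where
    strip : ∀ y → x⁻¹ * (x * y) ≈ y
    strip y = begin
      x⁻¹ * (x * y)  ≈⟨ *-assoc x⁻¹ x y ⟨
      x⁻¹ * x * y    ≈⟨ *-congʳ (trans (*-comm x⁻¹ x) xx⁻¹≈1) ⟩
      1# * y         ≈⟨ *-identityˡ y ⟩
      y              ∎

  x≉0∧xy≈0⇒y≈0 : ∀ {x y} → x ≉ 0# → x * y ≈ 0# → y ≈ 0#
  x≉0∧xy≈0⇒y≈0 {x} {y} x≉0 e = cancel-*ˡ y 0# x≉0 (trans e (sym (zeroʳ x)))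

  x*y≉0 : ∀ {x y} → x ≉ 0# → y ≉ 0# → x * y ≉ 0#
  x*y≉0 x≉0 y≉0 e = y≉0 (x≉0∧xy≈0⇒y≈0 x≉0 e)

  product≉0 : ∀ n (f : Fin n → Carrier) → (∀ i → f i ≉ 0#) → product f ≉ 0#
  product≉0 zero    f f≉0 = 1≉0
  product≉0 (suc n) f f≉0 = x*y≉0 (f≉0 Fin.zero) (product≉0 n _ λ i → f≉0 (Fin.suc i))

  1<|F| : ∀ {n} → HasCardinality setoid n → 1 < n
  1<|F| {zero}        fin = contradiction (Inverse.to fin 0#) λ ()
  1<|F| {suc zero}    fin = contradiction (begin
    1#                                    ≈⟨ Inverse.strictlyInverseʳ fin 1# ⟨
    Inverse.from fin (Inverse.to fin 1#)  ≈⟨ Inverse.from-cong fin (Fin1-irrelevant _ _) ⟩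
    Inverse.from fin (Inverse.to fin 0#)  ≈⟨ Inverse.strictlyInverseʳ fin 0# ⟩
    0#                                    ∎) 1≉0
    where
    Fin1-irrelevant : ∀ (i j : Fin 1) → i ≡ j
    Fin1-irrelevant Fin.zero Fin.zero = ≡.refl
  1<|F| {suc (suc n)} fin = s≤s (s≤s z≤n)

  private
    -- Putting 1 in place of the zero element lets a product over the nonzero elements run over all
    -- indices, where a permutation can act. With z = y the factor is the element itself, with z = x
    -- it is the multiplier that y receives.
    unlessZero : Carrier → Carrier → Carrier
    unlessZero y z = if does (y ≟ 0#) then 1# else z

    unlessZero-zero : ∀ {y} z → y ≈ 0# → unlessZero y z ≈ 1#
    unlessZero-zero {y} z y≈0 rewrite dec-true (y ≟ 0#) y≈0 = refl

    unlessZero-nonzero : ∀ {y} z → y ≉ 0# → unlessZero y z ≈ z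
    unlessZero-nonzero {y} z y≉0 rewrite dec-false (y ≟ 0#) y≉0 = refl

    unlessZero-cong : ∀ {x y} → x ≈ y → unlessZero x x ≈ unlessZero y y
    unlessZero-cong {x} {y} x≈y with y ≟ 0#
    ... | yes y≈0 = trans (unlessZero-zero x (trans x≈y y≈0)) (sym (unlessZero-zero y y≈0))
    ... | no y≉0  = begin
      unlessZero x x  ≈⟨ unlessZero-nonzero x (λ x≈0 → y≉0 (trans (sym x≈y) x≈0)) ⟩
      x               ≈⟨ x≈y ⟩
      y               ≈⟨ unlessZero-nonzero y y≉0 ⟨
      unlessZero y y  ∎

    unlessZero-* : ∀ {x} y → x ≉ 0# → unlessZero (x * y) (x * y) ≈ unlessZero y x * unlessZero y y
    unlessZero-* {x} y x≉0 with y ≟ 0#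
    ... | yes y≈0 = begin
      unlessZero (x * y) (x * y)       ≈⟨ unlessZero-zero _ (trans (*-congˡ y≈0) (zeroʳ x)) ⟩
      1#                               ≈⟨ *-identityˡ 1# ⟨
      1# * 1#                          ≈⟨ *-cong (unlessZero-zero x y≈0) (unlessZero-zero y y≈0) ⟨
      unlessZero y x * unlessZero y y  ∎
    ... | no y≉0  = begin
      unlessZero (x * y) (x * y)       ≈⟨ unlessZero-nonzero _ (x*y≉0 x≉0 y≉0) ⟩
      x * y                            ≈⟨ *-cong (unlessZero-nonzero x y≉0) (unlessZero-nonzero y y≉0) ⟨
      unlessZero y x * unlessZero y y  ∎

    unlessZero≉0 : ∀ y → unlessZero y y ≉ 0#
    unlessZero≉0 y e with y ≟ 0#
    ... | yes y≈0 = 1≉0 (trans (sym (unlessZero-zero y y≈0)) e)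
    ... | no y≉0  = y≉0 (trans (sym (unlessZero-nonzero y y≉0)) e)

  -- Multiplication by x ≠ 0 permutes the field, so the product of the nonzero
  -- elements is multiplied by 1 when each factor is multiplied by x.
  x^|F|≈x : ∀ {n} → HasCardinality setoid n → ∀ x → x ^ n ≈ x
  x^|F|≈x {zero} fin x = contradiction (Inverse.to fin 0#) λ ()
  x^|F|≈x {suc n} fin x with x ≟ 0#
  ... | yes x≈0 = begin
    x * x ^ n   ≈⟨ *-congʳ x≈0 ⟩
    0# * x ^ n  ≈⟨ zeroˡ (x ^ n) ⟩
    0#          ≈⟨ x≈0 ⟨
    x           ∎
  ... | no x≉0 = begin
    x * x ^ n   ≈⟨ *-congˡ x^n≈1 ⟩
    x * 1#      ≈⟨ *-identityʳ x ⟩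
    x           ∎
    where
    open Inverse fin using (to; from; to-cong) renaming (strictlyInverseˡ to to∘from; strictlyInverseʳ to from∘to)

    x⁻¹ : Carrier
    x⁻¹ = proj₁ (inverse x x≉0)

    xx⁻¹≈1 : x * x⁻¹ ≈ 1#
    xx⁻¹≈1 = proj₂ (inverse x x≉0)

    cancels : ∀ {u v} → u * v ≈ 1# → ∀ i → to (u * from (to (v * from i))) ≡ i
    cancels {u} {v} uv≈1 i = ≡.trans (to-cong (begin
      u * from (to (v * from i))  ≈⟨ *-congˡ (from∘to _) ⟩
      u * (v * from i)            ≈⟨ *-assoc u v _ ⟨
      u * v * from i              ≈⟨ *-congʳ uv≈1 ⟩
      1# * from i                 ≈⟨ *-identityˡ _ ⟩
      from i                      ∎)) (to∘from i)

    π : Permutation (suc n) (suc n)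
    π = permutation (λ i → to (x * from i)) (λ i → to (x⁻¹ * from i))
      (cancels xx⁻¹≈1) (cancels (trans (*-comm x⁻¹ x) xx⁻¹≈1))

    ψ : Fin (suc n) → Carrier
    ψ i = unlessZero (from i) x

    ϕ : Fin (suc n) → Carrier
    ϕ i = unlessZero (from i) (from i)

    -- `ψ` is 1 at this index and x at the other n, hence the exponent n in `x^n≈1`.
    i₀ : Fin (suc n)
    i₀ = to 0#

    x^n≈1 : x ^ n ≈ 1#
    x^n≈1 = begin
      x ^ n                          ≈⟨ product-replicate n ⟨
      product {n} (replicate n x)    ≈⟨ product-cong (λ i → sym (unlessZero-nonzero x λ e →
                                          punchInᵢ≢i i₀ i (≡.trans (≡.sym (to∘from _)) (to-cong e)))) ⟩
      product (removeAt ψ i₀)        ≈⟨ *-identityˡ _ ⟨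
      1# * product (removeAt ψ i₀)   ≈⟨ *-congʳ (unlessZero-zero x (from∘to 0#)) ⟨
      ψ i₀ * product (removeAt ψ i₀) ≈⟨ product-remove ψ ⟨
      product ψ                      ≈⟨ cancel-*ˡ _ _ (product≉0 _ ϕ λ i → unlessZero≉0 (from i)) (begin
        product ϕ * product ψ          ≈⟨ *-comm _ _ ⟩
        product ψ * product ϕ          ≈⟨ ∏-distrib-* ψ ϕ ⟨
        product (λ i → ψ i * ϕ i)      ≈⟨ product-cong (λ i → trans
                                            (unlessZero-cong (from∘to _)) (unlessZero-* (from i) x≉0)) ⟨
        product (λ i → ϕ (to (x * from i)))  ≈⟨ product-permute ϕ π ⟨
        product ϕ                      ≈⟨ *-identityʳ _ ⟨
        product ϕ * 1#                 ∎) ⟩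
      1#                             ∎

  x^q^k≈x : ∀ k x → x ^ (q ℕ.^ k) ≈ x
  x^q^k≈x zero    x = *-identityʳ x
  x^q^k≈x (suc k) x = begin
    x ^ (q ℕ.* q ℕ.^ k)    ≈⟨ ^-assocʳ x q _ ⟨
    (x ^ q) ^ (q ℕ.^ k)    ≈⟨ ^-congˡ (q ℕ.^ k) (x^|F|≈x finite x) ⟩
    x ^ (q ℕ.^ k)          ≈⟨ x^q^k≈x k x ⟩
    x                      ∎

-- Congruence and divisibility

module QuotientProperties {c ℓ} (R : CommutativeRing c ℓ) (g : CommutativeRing.Carrier R) where
  open CommutativeRing R
  open AbelianGroupProperties +-abelianGroup using (ε⁻¹≈ε; x≈y⇒x∙y⁻¹≈ε)
  open SemiringDivisibility semiring
  open SemiringExp semiring using (_^_)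
  open Quotient R g using (_≈ₘ_; quotient)
  open SemiringExp (CommutativeRing.semiring quotient) using () renaming (_^_ to _^ₘ_)

  x-0≈x : ∀ x → x - 0# ≈ x
  x-0≈x x = trans (+-congˡ ε⁻¹≈ε) (+-identityʳ x)

  ∣⇒≈ₘ0 : ∀ {x} → g ∣ x → x ≈ₘ 0#
  ∣⇒≈ₘ0 {x} = ∣ʳ-respʳ-≈ (sym (x-0≈x x))

  ≈ₘ0⇒∣ : ∀ {x} → x ≈ₘ 0# → g ∣ x
  ≈ₘ0⇒∣ {x} = ∣ʳ-respʳ-≈ (x-0≈x x)

  ≈⇒≈ₘ : ∀ {x y} → x ≈ y → x ≈ₘ y
  ≈⇒≈ₘ x≈y = ∣ʳ-respʳ-≈ (sym (x≈y⇒x∙y⁻¹≈ε x≈y)) (g ∣0)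

  -- The quotient keeps the carrier and the multiplication, so powers agree as elements, and a
  -- statement about powers moves between moduli by substitution.
  ^ₘ≡^ : ∀ x n → x ^ₘ n ≡ x ^ n
  ^ₘ≡^ x zero    = ≡.refl
  ^ₘ≡^ x (suc n) = ≡.cong (x *_) (^ₘ≡^ x n)

-- Polynomials over a finite field: degree and division with remainder

module PolynomialProperties {c ℓ} (F : FiniteField c ℓ) where
  open FiniteField F using (commutativeRing; isField; _≟_; q; finite)
  open CommutativeRing commutativeRing
  open IsField isField using (1≉0; inverse)
  open FiniteFieldProperties F
  open SemiringExp semiring using (_^_)
  open AbelianGroupProperties +-abelianGroup using (x∙y⁻¹≈ε⇒x≈y; identityʳ-unique)
  open CommutativeSemigroupProperties +-commutativeSemigroup using (interchange)
  open CommutativeSemigroupProperties *-commutativeSemigroup using (x∙yz≈y∙xz)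
  open RingProperties ring using (-0#≈0#)
  open Polynomials commutativeRing hiding (Poly; polynomialRing)
  open PolynomialsOver F hiding (_∣_)
  open SetoidReasoning setoid

  private
    module F[t] = CommutativeRing polynomialRing

  open SemiringDivisibility F[t].semiring
  open SemiringPrimality F[t].semiring using (Irreducible⇒≉0)

  -- A bound holds of the zero polynomial without a special case, whereas `degree` gives it a junk
  -- value, and it respects `≈ₚ` without removal of trailing zeros.
  DegreeBelow : ℕ → Poly → Set ℓ
  DegreeBelow n p = ∀ i → n ≤ i → coeff p i ≈ 0#

  record HasDegree (p : Poly) (n : ℕ) : Set ℓ where
    constructor hasDegree
    field
      leading≉0 : coeff p n ≉ 0#
      below     : DegreeBelow (suc n) p

  below-mono : ∀ {m n p} → m ≤ n → DegreeBelow m p → DegreeBelow n p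
  below-mono m≤n b i n≤i = b i (≤-trans m≤n n≤i)

  below-≈ : ∀ {n p r} → p ≈ₚ r → DegreeBelow n p → DegreeBelow n r
  below-≈ e b i n≤i = trans (sym (at e i)) (b i n≤i)

  below-minus : ∀ {n} p r → DegreeBelow n p → DegreeBelow n r → DegreeBelow n (p F[t].- r)
  below-minus p r bp br i n≤i = begin
    coeff (p +ₚ -ₚ r) i        ≈⟨ coeff-+ p (-ₚ r) i ⟩
    coeff p i + coeff (-ₚ r) i ≈⟨ +-cong (bp i n≤i) (trans (coeff-neg r i) (-‿cong (br i n≤i))) ⟩
    0# - 0#                    ≈⟨ -‿inverseʳ 0# ⟩
    0#                         ∎

  below-∷ : ∀ {n a p} → DegreeBelow n p → DegreeBelow (suc n) (a ∷ p)
  below-∷ b (suc i) (s≤s n≤i) = b i n≤i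

  below-length : ∀ p → DegreeBelow (length p) p
  below-length []      _ _ = refl
  below-length (a ∷ p)     = below-∷ (below-length p)

  below-0⇒≈[] : ∀ {p} → DegreeBelow 0 p → p ≈ₚ []
  below-0⇒≈[] b = coeffwise λ i → b i z≤n

  hasDegree⇒≉[] : ∀ {p n} → HasDegree p n → p F[t].≉ []
  hasDegree⇒≉[] {n = n} (hasDegree l≉0 _) e = l≉0 (at e n)

  degree-spec : ∀ p → p ≈ₚ [] ⊎ HasDegree p (degree p)
  degree-spec p with normalForm p
    where
    -- The induction must follow the shape of the normalised list, because `∷₀` tests its head
    -- against zero only when the normalised tail is empty.
    normalForm : ∀ p → (dropTrailingZeros p ≡ [] × p ≈ₚ []) ⊎
      (∃₂ λ b r → dropTrailingZeros p ≡ b ∷ r × HasDegree p (length r))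
    normalForm [] = inj₁ (≡.refl , F[t].refl)
    normalForm (a ∷ p) with normalForm p
    ... | inj₂ (b , r , eq , hasDegree l≉0 bel) rewrite eq =
      inj₂ (a , b ∷ r , ≡.refl , hasDegree l≉0 (below-∷ bel))
    ... | inj₁ (eq , p≈0) rewrite eq with a ≟ 0#
    ...   | yes a≈0 rewrite dec-true (a ≟ 0#) a≈0 =
      inj₁ (≡.refl , F[t].trans (∷-cong a≈0 p≈0) 0∷[])
    ...   | no a≉0 rewrite dec-false (a ≟ 0#) a≉0 =
      inj₂ (a , [] , ≡.refl , hasDegree a≉0 (below-∷ λ i _ → at p≈0 i))
  ... | inj₁ (_ , p≈0) = inj₁ p≈0
  ... | inj₂ (b , r , eq , deg) =
    inj₂ (≡.subst (λ s → HasDegree p (pred (length s))) (≡.sym eq) deg)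

  ≉[]⇒hasDegree : ∀ {p} → p F[t].≉ [] → HasDegree p (degree p)
  ≉[]⇒hasDegree {p} p≉0 with degree-spec p
  ... | inj₁ p≈0 = contradiction p≈0 p≉0
  ... | inj₂ deg = deg

  coeff-*∷ : ∀ a k g i → coeff ((a ∷ k) *ₚ g) i ≈ a * coeff g i + coeff (0# ∷ k *ₚ g) i
  coeff-*∷ a k g i = trans (coeff-+ (a ·ₚ g) _ i) (+-congʳ (coeff-· a g i))

  -- Degrees add since the leading coefficient of g is not a zero divisor. Beyond index n the
  -- summand `a ·ₚ g` vanishes, so a bound on the product passes to the product with the tail. The
  -- case m = 0 says that only the zero multiple of g has degree below n.
  below-*⇒below : ∀ {g n} → HasDegree g n → ∀ m k → DegreeBelow (m ℕ.+ n) (k *ₚ g) → DegreeBelow m k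
  below-*⇒below deg m [] b i m≤i = refl
  below-*⇒below {g} {n} deg@(hasDegree l≉0 bg) m (a ∷ k) b = go m b
    where
    shifted : ∀ {m} → DegreeBelow (suc m ℕ.+ n) ((a ∷ k) *ₚ g) → DegreeBelow (m ℕ.+ n) (k *ₚ g)
    shifted {m} b i m+n≤i = begin
      coeff (k *ₚ g) i                            ≈⟨ +-identityˡ _ ⟨
      0# + coeff (k *ₚ g) i                       ≈⟨ +-congʳ (zeroʳ a) ⟨
      a * 0# + coeff (k *ₚ g) i                   ≈⟨ +-congʳ (*-congˡ (bg (suc i) (s≤s (≤-trans (m≤n+m n m) m+n≤i)))) ⟨
      a * coeff g (suc i) + coeff (k *ₚ g) i      ≈⟨ coeff-*∷ a k g (suc i) ⟨
      coeff ((a ∷ k) *ₚ g) (suc i)                ≈⟨ b (suc i) (s≤s m+n≤i) ⟩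
      0#                                          ∎

    go : ∀ m → DegreeBelow (m ℕ.+ n) ((a ∷ k) *ₚ g) → DegreeBelow m (a ∷ k)
    go (suc m) b = below-∷ (below-*⇒below deg m k (shifted b))
    -- The tail vanishes by the bound weakened by one; what is left at index n of the product is `a`
    -- times the leading coefficient of g.
    go zero b = λ where
        zero    _ → x≉0∧xy≈0⇒y≈0 l≉0 (trans (*-comm _ a) a*l≈0)
        (suc i) _ → at k≈0 i
      where
      k≈0 : k ≈ₚ []
      k≈0 = below-0⇒≈[] (below-*⇒below deg 0 k (shifted (below-mono {p = (a ∷ k) *ₚ g} (n≤1+n n) b)))

      a*l≈0 : a * coeff g n ≈ 0#
      a*l≈0 = begin
        a * coeff g n                             ≈⟨ +-identityʳ _ ⟨
        a * coeff g n + 0#                        ≈⟨ +-congˡ (at (F[t].trans (∷-cong refl (*-congₚ k≈0 (F[t].refl {g}))) 0∷[]) n) ⟨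
        a * coeff g n + coeff (0# ∷ k *ₚ g) n     ≈⟨ coeff-*∷ a k g n ⟨
        coeff ((a ∷ k) *ₚ g) n                    ≈⟨ b n ≤-refl ⟩
        0#                                        ∎

  below∧∣⇒≈[] : ∀ {g n r} → HasDegree g n → DegreeBelow n r → g ∣ r → r ≈ₚ []
  below∧∣⇒≈[] {g} {n} {r} deg b (k , kg≈r) = F[t].trans (F[t].sym kg≈r)
    (*-congₚ {k} {[]} {g} (below-0⇒≈[] (below-*⇒below deg 0 k (below-≈ (F[t].sym kg≈r) b))) F[t].refl)

  -- Abstract because conversion checking would otherwise unfold the division.
  abstract
    divMod : ∀ {g n} → HasDegree g n → ∀ p → ∃₂ λ s r → p ≈ₚ s *ₚ g +ₚ r × DegreeBelow n r
    divMod deg [] = [] , [] , F[t].refl , λ _ _ → refl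
    divMod {g} {n} deg@(hasDegree l≉0 bg) (a ∷ p) with divMod deg p | inverse (coeff g n) l≉0
    ... | s , r , p≈sg+r , br | l⁻¹ , ll⁻¹≈1 = b ∷ s , r′ , split , br′
      where
      -- Once the tail is divided, a + t r has degree at most n; b is the multiple of g that cancels
      -- its coefficient at n.
      b : Carrier
      b = coeff (a ∷ r) n * l⁻¹

      r′ : Poly
      r′ = (a ∷ r) F[t].- b ·ₚ g

      split : a ∷ p ≈ₚ (b ∷ s) *ₚ g +ₚ r′
      split = F[t]R.begin
        a ∷ p                                                  F[t]R.≈⟨ ∷-cong (sym (+-identityˡ a)) p≈sg+r ⟩
        (0# ∷ s *ₚ g) +ₚ (a ∷ r)                               F[t]R.≈⟨ F[t].+-congʳ {a ∷ r} (xyx⁻¹≈yₚ (b ·ₚ g) (0# ∷ s *ₚ g)) ⟨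
        ((b ∷ s) *ₚ g F[t].- b ·ₚ g) +ₚ (a ∷ r)                F[t]R.≈⟨ F[t].+-assoc ((b ∷ s) *ₚ g) (-ₚ (b ·ₚ g)) (a ∷ r) ⟩
        (b ∷ s) *ₚ g +ₚ (-ₚ (b ·ₚ g) +ₚ (a ∷ r))               F[t]R.≈⟨ F[t].+-congˡ {(b ∷ s) *ₚ g} (F[t].+-comm (-ₚ (b ·ₚ g)) (a ∷ r)) ⟩
        (b ∷ s) *ₚ g +ₚ r′                                     F[t]R.∎
        where
        module F[t]R = SetoidReasoning F[t].setoid
        open AbelianGroupProperties F[t].+-abelianGroup using () renaming (xyx⁻¹≈y to xyx⁻¹≈yₚ)

      coeff-r′ : ∀ i → coeff r′ i ≈ coeff (a ∷ r) i - b * coeff g i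
      coeff-r′ i = trans (coeff-+ (a ∷ r) (-ₚ (b ·ₚ g)) i)
        (+-congˡ (trans (coeff-neg (b ·ₚ g) i) (-‿cong (coeff-· b g i))))

      br′ : DegreeBelow n r′
      br′ i n≤i with m≤n⇒m<n∨m≡n n≤i
      ... | inj₁ (s≤s {n = j} n≤j) = below-minus (a ∷ r) (b ·ₚ g) (below-∷ {p = r} br)
        (λ j n<j → trans (coeff-· b g j) (trans (*-congˡ (bg j n<j)) (zeroʳ b))) (suc j) (s≤s n≤j)
      ... | inj₂ ≡.refl = begin
        coeff r′ n                            ≈⟨ coeff-r′ n ⟩
        coeff (a ∷ r) n - b * coeff g n       ≈⟨ +-congˡ (-‿cong (begin
          coeff (a ∷ r) n * l⁻¹ * coeff g n     ≈⟨ *-assoc _ l⁻¹ _ ⟩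
          coeff (a ∷ r) n * (l⁻¹ * coeff g n)   ≈⟨ *-congˡ (trans (*-comm l⁻¹ _) ll⁻¹≈1) ⟩
          coeff (a ∷ r) n * 1#                  ≈⟨ *-identityʳ _ ⟩
          coeff (a ∷ r) n                       ∎)) ⟩
        coeff (a ∷ r) n - coeff (a ∷ r) n     ≈⟨ -‿inverseʳ _ ⟩
        0#                                    ∎

  -- Evaluation and the number of roots

  eval : Poly → Carrier → Carrier
  eval []      x = 0#
  eval (a ∷ p) x = a + x * eval p x

  eval-[] : ∀ {p} → p ≈ₚ [] → ∀ x → eval p x ≈ 0#
  eval-[] {[]}    e x = refl
  eval-[] {a ∷ p} e x = begin
    a + x * eval p x   ≈⟨ +-cong (at e 0) (*-congˡ (eval-[] {p} (coeffwise λ i → at e (suc i)) x)) ⟩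
    0# + x * 0#        ≈⟨ trans (+-identityˡ _) (zeroʳ x) ⟩
    0#                 ∎

  eval-cong : ∀ {p r} → p ≈ₚ r → ∀ x → eval p x ≈ eval r x
  eval-cong {[]}    {r}     e x = sym (eval-[] (F[t].sym e) x)
  eval-cong {a ∷ p} {[]}    e x = eval-[] e x
  eval-cong {a ∷ p} {b ∷ r} e x = +-cong (at e 0) (*-congˡ (eval-cong {p} {r} (coeffwise λ i → at e (suc i)) x))

  eval-+ : ∀ p r x → eval (p +ₚ r) x ≈ eval p x + eval r x
  eval-+ []      r       x = sym (+-identityˡ _)
  eval-+ (a ∷ p) []      x = sym (+-identityʳ _)
  eval-+ (a ∷ p) (b ∷ r) x = begin
    a + b + x * eval (p +ₚ r) x            ≈⟨ +-congˡ (trans (*-congˡ (eval-+ p r x)) (distribˡ x _ _)) ⟩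
    a + b + (x * eval p x + x * eval r x)  ≈⟨ interchange a b _ _ ⟩
    a + x * eval p x + (b + x * eval r x)  ∎

  eval-· : ∀ a p x → eval (a ·ₚ p) x ≈ a * eval p x
  eval-· a []      x = sym (zeroʳ a)
  eval-· a (b ∷ p) x = begin
    a * b + x * eval (a ·ₚ p) x    ≈⟨ +-congˡ (*-congˡ (eval-· a p x)) ⟩
    a * b + x * (a * eval p x)     ≈⟨ +-congˡ (x∙yz≈y∙xz x a _) ⟩
    a * b + a * (x * eval p x)     ≈⟨ distribˡ a b _ ⟨
    a * (b + x * eval p x)         ∎

  eval-* : ∀ p r x → eval (p *ₚ r) x ≈ eval p x * eval r x
  eval-* []      r x = sym (zeroˡ _)
  eval-* (a ∷ p) r x = begin
    eval (a ·ₚ r +ₚ (0# ∷ p *ₚ r)) x              ≈⟨ eval-+ (a ·ₚ r) _ x ⟩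
    eval (a ·ₚ r) x + (0# + x * eval (p *ₚ r) x)  ≈⟨ +-cong (eval-· a r x) (trans (+-identityˡ _) (*-congˡ (eval-* p r x))) ⟩
    a * eval r x + x * (eval p x * eval r x)      ≈⟨ +-congˡ (*-assoc x _ _) ⟨
    a * eval r x + x * eval p x * eval r x        ≈⟨ distribʳ _ a _ ⟨
    (a + x * eval p x) * eval r x                 ∎

  t- : Carrier → Poly
  t- x = - x ∷ 1# ∷ []

  t-hasDegree : ∀ x → HasDegree (t- x) 1
  t-hasDegree x = hasDegree 1≉0 (below-length (t- x))

  eval-t- : ∀ x y → eval (t- x) y ≈ y - x
  eval-t- x y = begin
    - x + y * (1# + y * 0#)  ≈⟨ +-congˡ (*-congˡ (trans (+-congˡ (zeroʳ y)) (+-identityʳ 1#))) ⟩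
    - x + y * 1#             ≈⟨ +-congˡ (*-identityʳ y) ⟩
    - x + y                  ≈⟨ +-comm (- x) y ⟩
    y - x                    ∎

  -- Division by t - x leaves a constant, and evaluation at x shows that this constant is p(x).
  root⇒factor : ∀ p x → eval p x ≈ 0# → ∃ λ s → p ≈ₚ s *ₚ t- x
  root⇒factor p x px≈0 with divMod (t-hasDegree x) p
  ... | s , r , e , br = s , F[t].trans e (F[t].trans (F[t].+-congˡ {s *ₚ t- x} r≈0) (F[t].+-identityʳ _))
    where
    r-constant : r ≈ₚ coeff r 0 ∷ []
    r-constant = coeffwise λ { zero → refl ; (suc i) → br (suc i) (s≤s z≤n) }

    r₀≈0 : coeff r 0 ≈ 0#
    r₀≈0 = begin
      coeff r 0                                ≈⟨ trans (+-congˡ (zeroʳ x)) (+-identityʳ _) ⟨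
      eval (coeff r 0 ∷ []) x                  ≈⟨ eval-cong {r} r-constant x ⟨
      eval r x                                 ≈⟨ trans (+-congʳ (zeroʳ _)) (+-identityˡ _) ⟨
      eval s x * 0# + eval r x                 ≈⟨ +-congʳ (*-congˡ (trans (eval-t- x x) (-‿inverseʳ x))) ⟨
      eval s x * eval (t- x) x + eval r x      ≈⟨ +-congʳ (eval-* s (t- x) x) ⟨
      eval (s *ₚ t- x) x + eval r x            ≈⟨ eval-+ (s *ₚ t- x) r x ⟨
      eval (s *ₚ t- x +ₚ r) x                  ≈⟨ eval-cong e x ⟨
      eval p x                                 ≈⟨ px≈0 ⟩
      0#                                       ∎

    r≈0 : r ≈ₚ []
    r≈0 = F[t].trans r-constant (F[t].trans (∷-cong r₀≈0 F[t].refl) 0∷[])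

  -- Splitting off t - x₀ lowers the bound by one. The cofactor vanishes at the other points because
  -- their differences from x₀ are nonzero.
  roots⇒≈[] : ∀ m p (x : Fin m → Carrier) → (∀ i j → x i ≈ x j → i ≡ j) →
              DegreeBelow m p → (∀ i → eval p (x i) ≈ 0#) → p ≈ₚ []
  roots⇒≈[] zero    p x inj b z = below-0⇒≈[] b
  roots⇒≈[] (suc m) p x inj b z with root⇒factor p (x Fin.zero) (z Fin.zero)
  ... | s , p≈s[t-x₀] = F[t].trans p≈s[t-x₀] (*-congₚ {s} {[]} {t- (x Fin.zero)} s≈0 F[t].refl)
    where
    x₀ = x Fin.zero

    s≈0 : s ≈ₚ []
    s≈0 = roots⇒≈[] m s (λ i → x (Fin.suc i)) (λ i j e → suc-injective (inj _ _ e))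
      (below-*⇒below (t-hasDegree x₀) m s
        (≡.subst (λ k → DegreeBelow k (s *ₚ t- x₀)) (ℕ.+-comm 1 m) (below-≈ p≈s[t-x₀] b)))
      λ i → x≉0∧xy≈0⇒y≈0 {x (Fin.suc i) - x₀}
        (λ e → 0≢1+n (≡.sym (inj _ _ (x∙y⁻¹≈ε⇒x≈y _ _ e)))) (begin
          (x (Fin.suc i) - x₀) * eval s (x (Fin.suc i))          ≈⟨ *-comm _ _ ⟩
          eval s (x (Fin.suc i)) * (x (Fin.suc i) - x₀)          ≈⟨ *-congˡ (eval-t- x₀ _) ⟨
          eval s (x (Fin.suc i)) * eval (t- x₀) (x (Fin.suc i))  ≈⟨ eval-* s (t- x₀) _ ⟨
          eval (s *ₚ t- x₀) (x (Fin.suc i))                      ≈⟨ eval-cong p≈s[t-x₀] _ ⟨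
          eval p (x (Fin.suc i))                                 ≈⟨ z (Fin.suc i) ⟩
          0#                                                     ∎)

  t^ : ℕ → Poly
  t^ zero    = 1# ∷ []
  t^ (suc n) = 0# ∷ t^ n

  t^-hasDegree : ∀ n → HasDegree (t^ n) n
  t^-hasDegree zero    = hasDegree 1≉0 (below-length (1# ∷ []))
  t^-hasDegree (suc n) with t^-hasDegree n
  ... | hasDegree l≉0 b = hasDegree l≉0 (below-∷ b)

  eval-t^ : ∀ n x → eval (t^ n) x ≈ x ^ n
  eval-t^ zero    x = trans (+-congˡ (zeroʳ x)) (+-identityʳ 1#)
  eval-t^ (suc n) x = trans (+-identityˡ _) (*-congˡ (eval-t^ n x))

  -- t^m - t has at most m roots in F.
  x^m≈x⇒q≤m : ∀ {m} → 1 < m → (∀ x → x ^ m ≈ x) → q ≤ m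
  -- Were m < q, the first m + 1 elements of the enumeration would be roots of t^m - t, and its
  -- coefficient at m would vanish. That coefficient is 1, since 1 < m keeps the term t away from
  -- index m.
  x^m≈x⇒q≤m {m} 1<m x^m≈x = ≮⇒≥ λ m<q → HasDegree.leading≉0 (t^-hasDegree m) (begin
    coeff (t^ m) m                      ≈⟨ trans (+-congˡ -0#≈0#) (+-identityʳ _) ⟨
    coeff (t^ m) m - 0#                 ≈⟨ +-congˡ (-‿cong (HasDegree.below (t^-hasDegree 1) m 1<m)) ⟨
    coeff (t^ m) m - coeff (t^ 1) m     ≈⟨ +-congˡ (coeff-neg (t^ 1) m) ⟨
    coeff (t^ m) m + coeff (-ₚ t^ 1) m  ≈⟨ coeff-+ (t^ m) (-ₚ t^ 1) m ⟨
    coeff (t^ m F[t].- t^ 1) m          ≈⟨ at (roots⇒≈[] (suc m) (t^ m F[t].- t^ 1)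
                                             (λ i → from (inject≤ i m<q))
                                             (λ i j e → inject≤-injective m<q m<q i j (from-injective e))
                                             (below-minus (t^ m) (t^ 1) (HasDegree.below (t^-hasDegree m))
                                               (below-mono {p = t^ 1} (m<n⇒m<1+n 1<m) (HasDegree.below (t^-hasDegree 1))))
                                             λ i → root (from (inject≤ i m<q))) m ⟩
    0#                                  ∎)
    where
    open Inverse finite using (from; to-cong; strictlyInverseˡ)

    from-injective : ∀ {i j} → from i ≈ from j → i ≡ j
    from-injective {i} {j} e = ≡.trans (≡.sym (strictlyInverseˡ i)) (≡.trans (to-cong e) (strictlyInverseˡ j))

    root : ∀ x → eval (t^ m F[t].- t^ 1) x ≈ 0#
    root x = identityʳ-unique x _ (begin
      x + eval (t^ m +ₚ -ₚ t^ 1) x                    ≈⟨ +-congʳ (trans (eval-t^ 1 x) (*-identityʳ x)) ⟨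
      eval (t^ 1) x + eval (t^ m F[t].- t^ 1) x       ≈⟨ eval-+ (t^ 1) (t^ m F[t].- t^ 1) x ⟨
      eval (t^ 1 +ₚ (t^ m F[t].- t^ 1)) x             ≈⟨ eval-cong {t^ 1 +ₚ (t^ m F[t].- t^ 1)} {t^ m} (F[t].trans
                                                          (F[t].sym (F[t].+-assoc (t^ 1) (t^ m) (-ₚ t^ 1)))
                                                          (xyx⁻¹≈yₚ (t^ 1) (t^ m))) x ⟩
      eval (t^ m) x                                   ≈⟨ trans (eval-t^ m x) (x^m≈x x) ⟩
      x                                               ∎)
      where open AbelianGroupProperties F[t].+-abelianGroup using () renaming (xyx⁻¹≈y to xyx⁻¹≈yₚ)

  -- Cancellation, units and cofactors

  *-cancelʳ : ∀ {g} → g F[t].≉ [] → ∀ x y → x *ₚ g ≈ₚ y *ₚ g → x ≈ₚ y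
  *-cancelʳ {g} g≉0 x y e = x∙y⁻¹≈ε⇒x≈yₚ x y (below-0⇒≈[]
    (below-*⇒below deg 0 (x F[t].- y) λ i _ → at (F[t].trans
      ([y-z]x≈yx-zxₚ g x y) (x≈y⇒x∙y⁻¹≈εₚ e)) i))
    where
    deg = ≉[]⇒hasDegree g≉0
    open AbelianGroupProperties F[t].+-abelianGroup using ()
      renaming (x∙y⁻¹≈ε⇒x≈y to x∙y⁻¹≈ε⇒x≈yₚ; x≈y⇒x∙y⁻¹≈ε to x≈y⇒x∙y⁻¹≈εₚ)
    open RingProperties F[t].ring using () renaming ([y-z]x≈yx-zx to [y-z]x≈yx-zxₚ)

  hasDegree-0⇒constant : ∀ {p} → HasDegree p 0 → p ≈ₚ coeff p 0 ∷ []
  hasDegree-0⇒constant (hasDegree _ b) = coeffwise λ { zero → refl ; (suc i) → b (suc i) (s≤s z≤n) }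

  hasDegree-0⇒∣1 : ∀ {p} → HasDegree p 0 → p ∣ F[t].1#
  hasDegree-0⇒∣1 {p} deg@(hasDegree l≉0 _) with inverse (coeff p 0) l≉0
  ... | l⁻¹ , ll⁻¹≈1 = l⁻¹ ∷ [] , F[t].trans (*-congˡₚ (l⁻¹ ∷ []) (hasDegree-0⇒constant deg))
    (∷-cong (trans (+-identityʳ _) (trans (*-comm l⁻¹ _) ll⁻¹≈1)) F[t].refl)

  ∤1⇒0<degree : ∀ {p} → p F[t].≉ [] → p ∤ F[t].1# → 0 < degree p
  ∤1⇒0<degree {p} p≉0 p∤1 with degree p | ≉[]⇒hasDegree p≉0
  ... | zero  | deg = contradiction (hasDegree-0⇒∣1 deg) p∤1
  ... | suc n | deg = s≤s z≤n

  irreducible⇒≉[] : ∀ {P} → Irreducible P → P F[t].≉ []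
  irreducible⇒≉[] = Irreducible⇒≉0 λ e → 1≉0 (sym (at e 0))

  -- A nonzero non-unit has degree at least 1, so dividing it out lowers the bound. This is the
  -- measure for the inductions over factorisations of g.
  below-cofactor : ∀ {N} x y → y F[t].≉ [] → y ∤ F[t].1# → DegreeBelow (suc N) (x *ₚ y) → DegreeBelow N x
  below-cofactor {N} x y y≉0 y∤1 b = below-*⇒below (≉[]⇒hasDegree y≉0) N x
    (below-mono {p = x *ₚ y} (≡.subst (_≤ N ℕ.+ degree y) (ℕ.+-comm N 1) (ℕ.+-monoʳ-≤ N (∤1⇒0<degree y≉0 y∤1))) b)

  hasDegree∧below⇒< : ∀ {p m n} → HasDegree p m → DegreeBelow n p → m < n
  hasDegree∧below⇒< (hasDegree l≉0 _) b = ≰⇒> λ n≤m → l≉0 (b _ n≤m)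

  coeff-tabulate : ∀ {m} (f : Fin m → Carrier) i → coeff (tabulate f) (toℕ i) ≈ f i
  coeff-tabulate f Fin.zero    = refl
  coeff-tabulate f (Fin.suc i) = coeff-tabulate (λ i → f (Fin.suc i)) i

  below-tabulate : ∀ {m} (f : Fin m → Carrier) → DegreeBelow m (tabulate f)
  below-tabulate f = ≡.subst (λ k → DegreeBelow k (tabulate f)) (length-tabulate f) (below-length (tabulate f))

  ≈ₚ-fromFin : ∀ {n} p r → DegreeBelow n p → DegreeBelow n r →
               (∀ (i : Fin n) → coeff p (toℕ i) ≈ coeff r (toℕ i)) → p ≈ₚ r
  ≈ₚ-fromFin {n} p r bp br e = coeffwise λ i → case i ℕ.<? n of λ where
    (yes i<n) → ≡.subst (λ j → coeff p j ≈ coeff r j) (toℕ-fromℕ< i<n) (e (fromℕ< i<n))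
    (no i≮n)  → trans (bp i (≮⇒≥ i≮n)) (sym (br i (≮⇒≥ i≮n)))

  -- Remainders: decidable divisibility and the size of the quotient

  module Residues {g n} (deg : HasDegree g n) where
    open Quotient polynomialRing g using (_≈ₘ_)
    open QuotientProperties polynomialRing g
    module Q = CommutativeRing F[t]/⟨ g ⟩

    remainder : Poly → Poly
    remainder p = proj₁ (proj₂ (divMod deg p))

    ≈ₘ-remainder : ∀ p → p ≈ₘ remainder p
    ≈ₘ-remainder p with divMod deg p
    ... | s , r , p≈sg+r , _ =
      s , F[t].sym (F[t].trans (F[t].+-congʳ { -ₚ r} p≈sg+r) (//-rightDividesʳ r (s *ₚ g)))
      where open AbelianGroupProperties F[t].+-abelianGroup using (//-rightDividesʳ)

    below-remainder : ∀ p → DegreeBelow n (remainder p)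
    below-remainder p = proj₂ (proj₂ (proj₂ (divMod deg p)))

    below∧≈ₘ⇒≈ₚ : ∀ p r → DegreeBelow n p → DegreeBelow n r → p ≈ₘ r → p ≈ₚ r
    below∧≈ₘ⇒≈ₚ p r bp br e = x∙y⁻¹≈ε⇒x≈yₚ p r (below∧∣⇒≈[] deg (below-minus p r bp br) e)
      where open AbelianGroupProperties F[t].+-abelianGroup using () renaming (x∙y⁻¹≈ε⇒x≈y to x∙y⁻¹≈ε⇒x≈yₚ)

    infix 4 _∣?
    _∣? : ∀ p → Dec (g ∣ p)
    _∣? p with degree-spec (remainder p)
    ... | inj₁ r≈0   = yes (≈ₘ0⇒∣ (Q.trans {p} {remainder p} {[]} (≈ₘ-remainder p) (≈⇒≈ₘ r≈0)))
    ... | inj₂ deg-r = no λ g∣p → hasDegree⇒≉[] deg-r (below∧∣⇒≈[] deg (below-remainder p)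
      (≈ₘ0⇒∣ (Q.trans {remainder p} {p} {[]} (Q.sym {p} {remainder p} (≈ₘ-remainder p)) (∣⇒≈ₘ0 g∣p))))

    -- Each class has exactly one representative of degree below n, and its n coefficients form a
    -- function from `Fin n` to `Fin q`.
    cardinality : HasCardinality Q.setoid (q ℕ.^ n)
    cardinality = record
      { to        = encode
      ; from      = decode
      ; to-cong   = encode-cong
      ; from-cong = λ { ≡.refl → Q.refl {decode _} }
      ; inverse   = (λ {k} {p} e → ≡.trans (encode-cong {p} e) (encode-decode k))
                  , (λ { {p} ≡.refl → decode-encode p })
      }
      where
      open Inverse finite

      encodeBelow : Poly → Fin (q ℕ.^ n)
      encodeBelow p = funToFin {n} λ i → to (coeff p (toℕ i))

      encode : Poly → Fin (q ℕ.^ n)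
      encode p = encodeBelow (remainder p)

      decode : Fin (q ℕ.^ n) → Poly
      decode k = tabulate {n = n} λ i → from (finToFun k i)

      encodeBelow-cong : ∀ {p r} → p ≈ₚ r → encodeBelow p ≡ encodeBelow r
      encodeBelow-cong e = funToFin-cong {n} λ i → to-cong (at e (toℕ i))

      encode≡encodeBelow : ∀ p r → p ≈ₘ r → DegreeBelow n r → encode p ≡ encodeBelow r
      encode≡encodeBelow p r p≈r br = encodeBelow-cong {remainder p} {r} (below∧≈ₘ⇒≈ₚ (remainder p) r (below-remainder p) br
        (Q.trans {remainder p} {p} {r} (Q.sym {p} {remainder p} (≈ₘ-remainder p)) p≈r))

      encode-cong : ∀ {p r} → p ≈ₘ r → encode p ≡ encode r
      encode-cong {p} {r} p≈r = encode≡encodeBelow p (remainder r)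
        (Q.trans {p} {r} {remainder r} p≈r (≈ₘ-remainder r)) (below-remainder r)

      encode-decode : ∀ k → encode (decode k) ≡ k
      encode-decode k = ≡.trans
        (encode≡encodeBelow (decode k) (decode k) (Q.refl {decode k}) (below-tabulate _))
        (≡.trans (funToFin-cong {n} λ i → ≡.trans (to-cong (coeff-tabulate _ i)) (strictlyInverseˡ _))
          (funToFin-finToFin {n} k))

      decode-encode : ∀ p → decode (encode p) ≈ₘ p
      decode-encode p = Q.trans {decode (encode p)} {remainder p} {p}
        (≈⇒≈ₘ {decode (encode p)} {remainder p} (≈ₚ-fromFin (decode (encode p)) (remainder p) (below-tabulate _) (below-remainder p) λ i → begin
          coeff (decode (encode p)) (toℕ i)   ≈⟨ coeff-tabulate {n} _ i ⟩
          from (finToFun (encode p) i)        ≡⟨ ≡.cong from (finToFun-funToFin {n} _ i) ⟩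
          from (to (coeff (remainder p) (toℕ i)))  ≈⟨ strictlyInverseʳ _ ⟩
          coeff (remainder p) (toℕ i)         ∎))
        (Q.sym {p} {remainder p} (≈ₘ-remainder p))

-- The residue field of an irreducible polynomial

module IrreducibleModulus {c ℓ} (F : FiniteField c ℓ)
    {P} (irr : PolynomialsOver.Irreducible F P) where
  open FiniteField F using (q)
  open Polynomials (FiniteField.commutativeRing F) using (_≈ₚ_; _+ₚ_; _*ₚ_; *-congˡₚ)
  open PolynomialsOver F hiding (_∣_)
  open PolynomialProperties F

  private
    module F[t] = CommutativeRing polynomialRing

  open SemiringDivisibility F[t].semiring
  open Irreducible irr renaming (p∤1 to P∤1)
  open Residues (≉[]⇒hasDegree (irreducible⇒≉[] irr))
  open Quotient polynomialRing P using (_≈ₘ_)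
  open QuotientProperties polynomialRing P
  open RingProperties Q.ring using (-‿distribˡ-*)
  open AbelianGroupProperties Q.+-abelianGroup using (inverseʳ-unique)

  private
    n = degree P

    -- The Euclidean algorithm: from P ≈ s x + r, an inverse of r gives one of x.
    inverse-below : ∀ N x → N ≤ n → DegreeBelow N x → x F[t].≉ [] → ∃ λ u → u *ₚ x ≈ₘ F[t].1#
    inverse-below zero    x N≤n b x≉0 = contradiction (below-0⇒≈[] b) x≉0
    inverse-below (suc N) x N≤n b x≉0 with divMod (≉[]⇒hasDegree x≉0) P
    ... | s , r , P≈sx+r , br with degree-spec r
    ...   | inj₂ deg-r = invert (inverse-below N r (ℕ.<⇒≤ N≤n)
              (below-mono {p = r} (s≤s⁻¹ (hasDegree∧below⇒< (≉[]⇒hasDegree x≉0) b)) br) (hasDegree⇒≉[] deg-r))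
      where
      -sx≈r : Q.- s *ₚ x ≈ₘ r
      -sx≈r = Q.trans {Q.- s *ₚ x} {Q.- (s *ₚ x)} {r} (Q.sym {Q.- (s *ₚ x)} {Q.- s *ₚ x} (-‿distribˡ-* s x))
        (Q.sym {r} {Q.- (s *ₚ x)} (inverseʳ-unique (s *ₚ x) r
          (∣⇒≈ₘ0 (∣ʳ-reflexive P≈sx+r))))

      invert : (∃ λ u → u *ₚ r ≈ₘ F[t].1#) → ∃ λ u → u *ₚ x ≈ₘ F[t].1#
      invert (u , ur≈1) = u *ₚ (Q.- s) , (begin
        (u *ₚ (Q.- s)) *ₚ x  ≈⟨ Q.*-assoc u (Q.- s) x ⟩
        u *ₚ ((Q.- s) *ₚ x)  ≈⟨ Q.*-congˡ {u} {(Q.- s) *ₚ x} {r} -sx≈r ⟩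
        u *ₚ r               ≈⟨ ur≈1 ⟩
        F[t].1#              ∎)
        where open SetoidReasoning Q.setoid
    -- Now P = s x, so s or x is a unit. A unit s would make x a multiple of P, which the degree of
    -- x forbids; a unit x is already inverted.
    ...   | inj₁ r≈0 with split-∣1 {s} {x} P≈sx
      where
      P≈sx : P ≈ₚ s *ₚ x
      P≈sx = F[t].trans P≈sx+r (F[t].trans (F[t].+-congˡ {s *ₚ x} r≈0) (F[t].+-identityʳ _))
    ...     | inj₂ (u , ux≈1) = u , ≈⇒≈ₘ ux≈1
    ...     | inj₁ (s⁻¹ , s⁻¹s≈1) = contradiction
              (below∧∣⇒≈[] (≉[]⇒hasDegree (irreducible⇒≉[] irr)) (below-mono {p = x} N≤n b)
                (s⁻¹ , (begin
                  s⁻¹ *ₚ P               ≈⟨ *-congˡₚ s⁻¹ P≈sx+r ⟩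
                  s⁻¹ *ₚ (s *ₚ x +ₚ r)   ≈⟨ *-congˡₚ s⁻¹ (F[t].+-congˡ {s *ₚ x} r≈0) ⟩
                  s⁻¹ *ₚ (s *ₚ x +ₚ [])  ≈⟨ *-congˡₚ s⁻¹ (F[t].+-identityʳ _) ⟩
                  s⁻¹ *ₚ (s *ₚ x)        ≈⟨ F[t].*-assoc s⁻¹ s x ⟨
                  (s⁻¹ *ₚ s) *ₚ x        ≈⟨ F[t].*-congʳ {x} s⁻¹s≈1 ⟩
                  F[t].1# *ₚ x           ≈⟨ F[t].*-identityˡ x ⟩
                  x                      ∎)))
              x≉0
      where open SetoidReasoning F[t].setoid

  residueField : FiniteField c (c ⊔ ℓ)
  residueField = record
    { ring    = Q.ring
    ; isField = record
      { *-comm  = Q.*-comm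
      ; 1≉0     = λ e → P∤1 (≈ₘ0⇒∣ e)
      ; inverse = inverseₘ
      }
    ; q       = q ℕ.^ degree P
    ; finite  = cardinality
    }
    where
    inverseₘ : ∀ x → ¬ x ≈ₘ [] → ∃ λ y → x *ₚ y ≈ₘ F[t].1#
    inverseₘ x x≉0 = u , (begin
      x *ₚ u            ≈⟨ Q.*-comm x u ⟩
      u *ₚ x            ≈⟨ Q.*-congˡ {u} {x} {remainder x} (≈ₘ-remainder x) ⟩
      u *ₚ remainder x  ≈⟨ proj₂ inv ⟩
      F[t].1#           ∎)
      where
      open SetoidReasoning Q.setoid

      -- The Euclidean algorithm expects a degree below n, so the remainder stands in for x.
      inv : ∃ λ u → u *ₚ remainder x ≈ₘ F[t].1#
      inv = inverse-below n (remainder x) ≤-refl (below-remainder x)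
        λ r≈0 → x≉0 (Q.trans {x} {remainder x} {[]} (≈ₘ-remainder x) (≈⇒≈ₘ r≈0))

      u : Poly
      u = proj₁ inv

  -- The residue field has no zero divisors.
  euclidsLemma : ∀ x y → P ∣ x *ₚ y → P ∤ x → P ∣ y
  euclidsLemma x y P∣xy P∤x = ≈ₘ0⇒∣ (x≉0∧xy≈0⇒y≈0′ {x} {y} (λ e → P∤x (≈ₘ0⇒∣ e)) (∣⇒≈ₘ0 P∣xy))
    where open FiniteFieldProperties residueField using () renaming (x≉0∧xy≈0⇒y≈0 to x≉0∧xy≈0⇒y≈0′)

-- Power maps that fix a finite field

module PowerMapFixedPoints {c ℓ} (K : FiniteField c ℓ) where
  open FiniteField K using (commutativeRing; q)
  open CommutativeRing commutativeRing
  open SemiringExp semiring using (_^_; ^-congˡ; ^-congʳ; ^-assocʳ)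
  open FiniteFieldProperties K
  open PolynomialProperties K
  open SetoidReasoning setoid

  -- Here `q` is the size of K, and b stands for the size of the ground field.
  x^b^n≈x⇒d∣n : ∀ {b d n} .{{_ : NonZero d}} → 1 < b → q ≡ b ℕ.^ d →
                (∀ x → x ^ (b ℕ.^ n) ≈ x) → d ∣ℕ n
  -- For r = 0 the polynomial t^(b^r) - t is zero and bounds nothing; 0 < r supplies the hypothesis
  -- 1 < b^r of the root bound.
  x^b^n≈x⇒d∣n {b} {d} {n} 1<b q≡b^d x^b^n≈x = m%n≡0⇒n∣m n d (ℕ.n≤0⇒n≡0 (≮⇒≥ λ 0<r →
    ℕ.<⇒≱ (^-monoʳ-< b 1<b (m%n<n n d))
      (≡.subst (_≤ b ℕ.^ r) q≡b^d (x^m≈x⇒q≤m (^-monoʳ-< b 1<b 0<r) x^b^r≈x))))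
    where
    r = n % d
    k = n / d

    q^k*b^r≡b^n : q ℕ.^ k ℕ.* b ℕ.^ r ≡ b ℕ.^ n
    q^k*b^r≡b^n = ≡R.begin
      q ℕ.^ k ℕ.* b ℕ.^ r          ≡R.≡⟨ ≡.cong (λ m → m ℕ.^ k ℕ.* b ℕ.^ r) q≡b^d ⟩
      (b ℕ.^ d) ℕ.^ k ℕ.* b ℕ.^ r  ≡R.≡⟨ ≡.cong (ℕ._* b ℕ.^ r) (ℕ.^-*-assoc b d k) ⟩
      b ℕ.^ (d ℕ.* k) ℕ.* b ℕ.^ r  ≡R.≡⟨ ℕ.^-distribˡ-+-* b (d ℕ.* k) r ⟨
      b ℕ.^ (d ℕ.* k ℕ.+ r)        ≡R.≡⟨ ≡.cong (b ℕ.^_) (≡.trans (ℕ.+-comm (d ℕ.* k) r) (≡.cong (r ℕ.+_) (ℕ.*-comm d k))) ⟩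
      b ℕ.^ (r ℕ.+ k ℕ.* d)        ≡R.≡⟨ ≡.cong (b ℕ.^_) (m≡m%n+[m/n]*n n d) ⟨
      b ℕ.^ n                      ≡R.∎
      where module ≡R = ≡-Reasoning

    -- As n = k d + r and the power b^d = q is the identity on K, the power b^n acts as b^r.
    x^b^r≈x : ∀ x → x ^ (b ℕ.^ r) ≈ x
    x^b^r≈x x = begin
      x ^ (b ℕ.^ r)                ≈⟨ ^-congˡ (b ℕ.^ r) (x^q^k≈x k x) ⟨
      (x ^ (q ℕ.^ k)) ^ (b ℕ.^ r)  ≈⟨ ^-assocʳ x (q ℕ.^ k) (b ℕ.^ r) ⟩
      x ^ (q ℕ.^ k ℕ.* b ℕ.^ r)    ≈⟨ ^-congʳ x q^k*b^r≡b^n ⟩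
      x ^ (b ℕ.^ n)                ≈⟨ x^b^n≈x x ⟩
      x                            ∎

-- Necessity of square-freeness and of the degree condition

module CarmichaelPolynomials {c ℓ} (F : FiniteField c ℓ) where
  open FiniteField F using (q; finite)
  open Polynomials (FiniteField.commutativeRing F)
    using (_≈ₚ_; _*ₚ_; *-congˡₚ; *-commₚ; *-assocₚ; *-identityˡₚ)
  open PolynomialsOver F hiding (_∣_)
  open PolynomialProperties F

  private
    module F[t] = CommutativeRing polynomialRing

  open SemiringDivisibility F[t].semiring
  open SemiringExp F[t].semiring using (_^_)
  open SemiringPrimality F[t].semiring using (mkIrred)
  open SetoidReasoning F[t].setoid

  *ₚ-absorb⇒∣1 : ∀ {x} a y → y F[t].≉ [] → (a *ₚ x) *ₚ y ≈ₚ y → x ∣ F[t].1#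
  *ₚ-absorb⇒∣1 {x} a y y≉0 e =
    a , *-cancelʳ y≉0 (a *ₚ x) F[t].1# (F[t].trans e (F[t].sym (*-identityˡₚ y)))

  0<degree : ∀ {P} → Irreducible P → 0 < degree P
  0<degree irr = ∤1⇒0<degree (irreducible⇒≉[] irr) (Irreducible.p∤1 irr)

  residueRing-cardinality : ∀ {g} → g F[t].≉ [] →
    HasCardinality (CommutativeRing.setoid F[t]/⟨ g ⟩) (q ℕ.^ degree g)
  residueRing-cardinality g≉0 = Residues.cardinality (≉[]⇒hasDegree g≉0)

  carmichael∧∣x*x⇒∣x : ∀ {g} → IsCarmichaelPolynomial g → ∀ x → g ∣ x *ₚ x → g ∣ x
  carmichael∧∣x*x⇒∣x {g} carmichael x g∣xx = ≈ₘ0⇒∣ (go size finite′ (a^|S|≈a x))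
    where
    open IsCarmichaelRing carmichael renaming (finite to finite′)
    open QuotientProperties polynomialRing g
    open Quotient polynomialRing g using (_≈ₘ_)
    module Q = CommutativeRing F[t]/⟨ g ⟩
    open SemiringExp Q.semiring using () renaming (_^_ to _^ₘ_)

    -- Only a size of at least 2 makes x² a factor of the power. Size 0 is impossible as the ring
    -- has a zero, and size 1 makes every element zero.
    go : ∀ n → HasCardinality Q.setoid n → x ^ₘ n ≈ₘ x → x ≈ₘ []
    go zero          fin e = contradiction (Inverse.to fin []) λ ()
    go (suc zero)    fin e = Q.trans {x} {Inverse.from fin Fin.zero} {[]}
      (Q.sym {Inverse.from fin Fin.zero} {x} (toZero x)) (toZero [])
      where
      toZero : ∀ y → Inverse.from fin Fin.zero ≈ₘ y
      toZero y with Inverse.to fin y | Inverse.strictlyInverseʳ fin y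
      ... | Fin.zero | e = e
    go (suc (suc n)) fin e = Q.trans {x} {x *ₚ (x *ₚ (x ^ₘ n))} {[]} (Q.sym {x *ₚ (x *ₚ (x ^ₘ n))} {x} e)
      (∣⇒≈ₘ0 (∣ʳ-respʳ-≈ (F[t].trans (*-commₚ (x ^ₘ n) (x *ₚ x)) (*-assocₚ x x (x ^ₘ n)))
        (x∣ʳy⇒x∣ʳzy (x ^ₘ n) g∣xx)))

  -- For g = h d d the nilpotent is h d, whose square is h g. So g divides h d, say k g = h d; this
  -- reads (k d)(h d) = h d, and cancelling h d leaves k d = 1.
  carmichael⇒squareFree : ∀ {g} → g F[t].≉ [] → IsCarmichaelPolynomial g → IsSquareFree g
  carmichael⇒squareFree {g} g≉0 carmichael d (h , hdd≈g) = *ₚ-absorb⇒∣1 k (h *ₚ d) hd≉0 (begin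
    (k *ₚ d) *ₚ (h *ₚ d)  ≈⟨ *-assocₚ k d (h *ₚ d) ⟩
    k *ₚ (d *ₚ (h *ₚ d))  ≈⟨ *-congˡₚ k dhd≈g ⟩
    k *ₚ g                ≈⟨ _∣ʳ_.equality g∣hd ⟩
    h *ₚ d                ∎)
    where
    dhd≈g : d *ₚ (h *ₚ d) ≈ₚ g
    dhd≈g = F[t].trans (x∙yz≈y∙xz d h d) hdd≈g
      where open CommutativeSemigroupProperties F[t].*-commutativeSemigroup using (x∙yz≈y∙xz)

    g∣hd : g ∣ h *ₚ d
    g∣hd = carmichael∧∣x*x⇒∣x carmichael (h *ₚ d) (h , (begin
      h *ₚ g                ≈⟨ *-congˡₚ h dhd≈g ⟨
      h *ₚ (d *ₚ (h *ₚ d))  ≈⟨ *-assocₚ h d (h *ₚ d) ⟨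
      (h *ₚ d) *ₚ (h *ₚ d)  ∎))

    k : Poly
    k = _∣ʳ_.quotient g∣hd

    hd≉0 : h *ₚ d F[t].≉ []
    hd≉0 hd≈0 = g≉0 (begin
      g               ≈⟨ hdd≈g ⟨
      h *ₚ (d *ₚ d)   ≈⟨ *-assocₚ h d d ⟨
      (h *ₚ d) *ₚ d   ≈⟨ F[t].*-congʳ {d} hd≈0 ⟩
      []              ∎)

  carmichael⇒degree∣ : ∀ {g} → g F[t].≉ [] → IsCarmichaelPolynomial g →
                       ∀ P → Irreducible P → P ∣ g → degree P ∣ℕ degree g
  carmichael⇒degree∣ {g} g≉0 carmichael P irr P∣g =
    PowerMapFixedPoints.x^b^n≈x⇒d∣n (IrreducibleModulus.residueField F irr) {q} {degree P} {degree g}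
      {{>-nonZero (0<degree irr)}} (FiniteFieldProperties.1<|F| F finite) ≡.refl fixed
    where
    open IsCarmichaelRing carmichael using (size; a^|S|≈a) renaming (finite to S-finite)
    open SemiringExp (CommutativeRing.semiring F[t]/⟨ g ⟩) using () renaming (_^_ to _^g_)
    open SemiringExp (CommutativeRing.semiring F[t]/⟨ P ⟩) using () renaming (_^_ to _^P_)

    N = q ℕ.^ degree g

    -- The Carmichael structure carries its own size; counting remainders modulo g identifies it.
    size≡N : size ≡ N
    size≡N = cardinality-unique S-finite (residueRing-cardinality g≉0)

    fixed : ∀ x → P ∣ (x ^P N) F[t].- x
    fixed x = ≡.subst (λ y → P ∣ y F[t].- x) (≡.sym (QuotientProperties.^ₘ≡^ polynomialRing P x N))
      (∣ʳ-trans P∣g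
        (≡.subst (λ y → g ∣ y F[t].- x) (QuotientProperties.^ₘ≡^ polynomialRing g x N)
          (≡.subst (λ n → g ∣ (x ^g n) F[t].- x) size≡N (a^|S|≈a x))))

  -- Sufficiency of the two conditions

  irreducible∣x^q^n-x : ∀ {P n} → Irreducible P → degree P ∣ℕ n → ∀ x → P ∣ (x ^ (q ℕ.^ n)) F[t].- x
  irreducible∣x^q^n-x {P} {n} irr (divides k n≡k*d) x =
    ≡.subst (λ y → P ∣ y F[t].- x) (QuotientProperties.^ₘ≡^ polynomialRing P x (q ℕ.^ n))
      (≡.subst (λ m → P ∣ (x ^P m) F[t].- x) q^d^k≡q^n
        -- Fermat's identity in K, iterated k times, where n = k deg P.
        (FiniteFieldProperties.x^q^k≈x (IrreducibleModulus.residueField F irr) k x))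
    where
    open SemiringExp (CommutativeRing.semiring F[t]/⟨ P ⟩) using () renaming (_^_ to _^P_)

    q^d^k≡q^n : (q ℕ.^ degree P) ℕ.^ k ≡ q ℕ.^ n
    q^d^k≡q^n = ≡.trans (ℕ.^-*-assoc q (degree P) k)
      (≡.cong (q ℕ.^_) (≡.trans (ℕ.*-comm (degree P) k) (≡.sym n≡k*d)))

  -- The double negation spares a search for factors, and suffices because divisibility is decidable.
  ¬¬irreducibleFactor : ∀ N g → DegreeBelow N g → g F[t].≉ [] → g ∤ F[t].1# →
                        ¬ (∀ P → Irreducible P → P ∤ g)
  ¬¬irreducibleFactor zero    g b g≉0 g∤1 none = g≉0 (below-0⇒≈[] b)
  ¬¬irreducibleFactor (suc N) g b g≉0 g∤1 none =
    -- Without irreducible factors g would itself be irreducible, because by induction a proper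
    -- factor cannot lack them; yet g divides g.
    none g (mkIrred g∤1 split) ∣ʳ-refl
    where
    split : ∀ {x y} → g ≈ₚ x *ₚ y → x ∣ F[t].1# ⊎ y ∣ F[t].1#
    split {x} {y} g≈xy = case x ∣1? x≉0 of λ where
        (yes x∣1) → inj₁ x∣1
        (no x∤1)  → case y ∣1? y≉0 of λ where
          (yes y∣1) → inj₂ y∣1
          (no y∤1)  → contradiction
            (λ P irr P∣x → none P irr (∣ʳ-respʳ-≈ (F[t].trans (*-commₚ y x) (F[t].sym g≈xy)) (x∣ʳy⇒x∣ʳzy y P∣x)))
            (¬¬irreducibleFactor N x (below-cofactor x y y≉0 y∤1 (below-≈ g≈xy b)) x≉0 x∤1)
      where
      x≉0 : x F[t].≉ []
      x≉0 x≈0 = g≉0 (F[t].trans g≈xy (F[t].*-congʳ {y} x≈0))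

      y≉0 : y F[t].≉ []
      y≉0 y≈0 = g≉0 (F[t].trans g≈xy (F[t].trans (*-congˡₚ x y≈0) (F[t].zeroʳ x)))

      _∣1?_ : ∀ z → z F[t].≉ [] → Dec (z ∣ F[t].1#)
      z ∣1? z≉0 = Residues._∣? (≉[]⇒hasDegree z≉0) F[t].1#

  -- Write g = h P with P irreducible. By induction b = m h; square-freeness gives P ∤ h, so
  -- Euclid's lemma puts P into m, and h P divides b.
  squareFree∧irreducibles∣⇒∣ : ∀ N g → DegreeBelow N g → g F[t].≉ [] → IsSquareFree g →
    ∀ b → (∀ P → Irreducible P → P ∣ g → P ∣ b) → g ∣ b
  squareFree∧irreducibles∣⇒∣ zero    g below g≉0 sf b irr∣b = contradiction (below-0⇒≈[] below) g≉0
  squareFree∧irreducibles∣⇒∣ (suc N) g below g≉0 sf b irr∣b =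
    decidable-stable (Residues._∣? (≉[]⇒hasDegree g≉0) b) λ g∤b →
      ¬¬irreducibleFactor (suc N) g below g≉0 (λ g∣1 → g∤b (∣ʳ-trans g∣1 (1∣ b)))
        λ P irr P∣g → g∤b (peel P irr P∣g)
    where
    peel : ∀ P → Irreducible P → P ∣ g → g ∣ b
    peel P irr (h , hP≈g) = recombine h∣b
      where
      h∣g : h ∣ g
      h∣g = P , F[t].trans (*-commₚ P h) hP≈g

      P∤h : P ∤ h
      P∤h (k , kP≈h) = Irreducible.p∤1 irr (sf P (k , (begin
        k *ₚ (P *ₚ P)  ≈⟨ *-assocₚ k P P ⟨
        (k *ₚ P) *ₚ P  ≈⟨ F[t].*-congʳ {P} kP≈h ⟩
        h *ₚ P         ≈⟨ hP≈g ⟩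
        g              ∎)))

      h∣b : h ∣ b
      h∣b = squareFree∧irreducibles∣⇒∣ N h
        (below-cofactor h P (irreducible⇒≉[] irr) (Irreducible.p∤1 irr) (below-≈ (F[t].sym hP≈g) below))
        (λ h≈0 → g≉0 (F[t].trans (F[t].sym hP≈g) (F[t].*-congʳ {P} h≈0)))
        (λ d dd∣h → sf d (∣ʳ-trans dd∣h h∣g))
        b
        λ P′ irr′ P′∣h → irr∣b P′ irr′ (∣ʳ-trans P′∣h h∣g)

      recombine : h ∣ b → g ∣ b
      recombine (m , mh≈b) = k , (begin
        k *ₚ g         ≈⟨ *-congˡₚ k hP≈g ⟨
        k *ₚ (h *ₚ P)  ≈⟨ *-congˡₚ k (*-commₚ h P) ⟩
        k *ₚ (P *ₚ h)  ≈⟨ *-assocₚ k P h ⟨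
        (k *ₚ P) *ₚ h  ≈⟨ F[t].*-congʳ {h} (_∣ʳ_.equality P∣m) ⟩
        m *ₚ h         ≈⟨ mh≈b ⟩
        b              ∎)
        where
        P∣m : P ∣ m
        P∣m = IrreducibleModulus.euclidsLemma F irr h m
          (∣ʳ-respʳ-≈ (F[t].trans (F[t].sym mh≈b) (*-commₚ m h)) (irr∣b P irr (h , hP≈g))) P∤h

        k : Poly
        k = _∣ʳ_.quotient P∣m

  -- If g = x y, one factor is zero in the field, hence a multiple of g. Substituting it into g = x
  -- y and cancelling g shows that the other factor is a unit.
  field⇒irreducible : ∀ {g} → g F[t].≉ [] → IsField (CommutativeRing.ring F[t]/⟨ g ⟩) → Irreducible g
  field⇒irreducible {g} g≉0 isField = mkIrred (λ g∣1 → 1≉0 (∣⇒≈ₘ0 g∣1)) split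
    where
    open IsField isField using (1≉0; inverse)
    open QuotientProperties polynomialRing g
    open Quotient polynomialRing g using (_≈ₘ_)
    module Q = CommutativeRing F[t]/⟨ g ⟩

    split : ∀ {x y} → g ≈ₚ x *ₚ y → x ∣ F[t].1# ⊎ y ∣ F[t].1#
    split {x} {y} g≈xy with Residues._∣? (≉[]⇒hasDegree g≉0) x
    ... | yes (k , kg≈x) = inj₂ (*ₚ-absorb⇒∣1 k g g≉0 (begin
      (k *ₚ y) *ₚ g  ≈⟨ *-assocₚ k y g ⟩
      k *ₚ (y *ₚ g)  ≈⟨ *-congˡₚ k (*-commₚ y g) ⟩
      k *ₚ (g *ₚ y)  ≈⟨ *-assocₚ k g y ⟨
      (k *ₚ g) *ₚ y  ≈⟨ F[t].*-congʳ {y} kg≈x ⟩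
      x *ₚ y         ≈⟨ g≈xy ⟨
      g              ∎))
    ... | no g∤x with inverse x (λ x≈0 → g∤x (≈ₘ0⇒∣ x≈0))
    ...   | u , xu≈1 = fromDivides (≈ₘ0⇒∣ y≈0)
      where
      y≈0 : y ≈ₘ []
      y≈0 = Q≈.begin
        y                 Q≈.≈⟨ ≈⇒≈ₘ (*-identityˡₚ y) ⟨
        F[t].1# *ₚ y      Q≈.≈⟨ Q.*-congʳ {y} {x *ₚ u} {F[t].1#} xu≈1 ⟨
        (x *ₚ u) *ₚ y     Q≈.≈⟨ ≈⇒≈ₘ (F[t].*-congʳ {y} (*-commₚ x u)) ⟩
        (u *ₚ x) *ₚ y     Q≈.≈⟨ ≈⇒≈ₘ (*-assocₚ u x y) ⟩
        u *ₚ (x *ₚ y)     Q≈.≈⟨ ≈⇒≈ₘ (*-congˡₚ u g≈xy) ⟨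
        u *ₚ g            Q≈.≈⟨ ∣⇒≈ₘ0 (x∣ʳyx g u) ⟩
        []                Q≈.∎
        where module Q≈ = SetoidReasoning Q.setoid

      fromDivides : g ∣ y → x ∣ F[t].1# ⊎ y ∣ F[t].1#
      fromDivides (k , kg≈y) = inj₁ (*ₚ-absorb⇒∣1 k g g≉0 (begin
        (k *ₚ x) *ₚ g  ≈⟨ F[t].*-congʳ {g} (*-commₚ k x) ⟩
        (x *ₚ k) *ₚ g  ≈⟨ *-assocₚ x k g ⟩
        x *ₚ (k *ₚ g)  ≈⟨ *-congˡₚ x kg≈y ⟩
        x *ₚ y         ≈⟨ g≈xy ⟨
        g              ∎))

  squareFree∧degree∣⇒carmichael : ∀ {g} → IsComposite g → IsSquareFree g →
    (∀ P → Irreducible P → P ∣ g → degree P ∣ℕ degree g) → IsCarmichaelPolynomial g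
  squareFree∧degree∣⇒carmichael {g} composite sf degree∣ = record
    { size     = N
    ; finite   = residueRing-cardinality nonzero
    ; notField = λ isField → notIrreducible (field⇒irreducible nonzero isField)
    ; a^|S|≈a  = λ x → ≡.subst (λ y → g ∣ y F[t].- x)
        (≡.sym (QuotientProperties.^ₘ≡^ polynomialRing g x N))
        (squareFree∧irreducibles∣⇒∣ (suc (degree g)) g (HasDegree.below (≉[]⇒hasDegree nonzero)) nonzero sf _
          λ P irr P∣g → irreducible∣x^q^n-x irr (degree∣ P irr P∣g) x)
    }
    where
    open IsComposite composite
    N = q ℕ.^ degree g

theorem4p1 : ∀ {c ℓ} (F : FiniteField c ℓ) → let open PolynomialsOver F in
    (g : Poly) → IsComposite g →
    IsCarmichaelPolynomial g ⇔
    (IsSquareFree g × (∀ P → Irreducible P → P ∣ g → degree P ∣ℕ degree g))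
theorem4p1 F g composite = mk⇔
  (λ carmichael → carmichael⇒squareFree nonzero carmichael , carmichael⇒degree∣ nonzero carmichael)
  λ (sf , degree∣) → squareFree∧degree∣⇒carmichael composite sf degree∣
  where
  open PolynomialsOver.IsComposite composite using (nonzero)
  open CarmichaelPolynomials F
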